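{- Let $D,Q\in\mathbb N$ with $(D,Q)=1$ and $D/Q>1$, and suppose $D/Q$ is not the square of a rational number. Let $q$ be the smallest (positive) divisor of $Q$ such that $Q\mid q^2$, and put $D_1=Dq^2/Q\in\mathbb N$. Let $m\ge 0$ be an integer such that $\sqrt{D/Q}$ has the periodic continued fraction expansion $\sqrt{D/Q}=[b_0,\{b_1,\ldots,b_m,2b_0\}]$ with $b_0,\ldots,b_m\in\mathbb N$ ($m$ is not assumed to be smallest possible), and let $r_k/s_k$, $k=0,1,2,\ldots$, be the $k$th convergent of $\sqrt{D/Q}$. Let $r+s\sqrt{D_1}$ ($r,s\in\mathbb Z$) be a unit $>1$ of the ring $\mathbb Z[\sqrt{D_1}]$, and let $t=(r,q)$. Then $(r/t,\,sq/t)$ is a convergent of $\sqrt{D/Q}$, i.e., $(r/t,sq/t)=(r_k,s_k)$ for some $k\ge 0$. Moreover, if $(r/t,sq/t)=(r_k,s_k)$, then there is another unit $r'+s'\sqrt{D_1}$ ($r',s'\in\mathbb Z$) of $\mathbb Z[\sqrt{D_1}]$ such that $(r_{k+m+1},s_{k+m+1})=(r'/t,\,s'q/t)$, and $(r',q)=t$ for the same number $t$.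
   Context: $\mathbb N=\{1,2,3,\ldots\}$. For integers $a,b$ (not both zero), $(a,b)$ denotes the greatest common divisor when used as in $(D,Q)=1$, $t=(r,q)$, $(r',q)=t$; in expressions such as $(r/t,sq/t)=(r_k,s_k)$ it denotes an ordered pair. The notation $[b_0,\{b_1,\ldots,b_m,2b_0\}]$ denotes the infinite simple continued fraction with initial term $b_0$ followed by the block $b_1,\ldots,b_m,2b_0$ (of length $m+1$) repeated periodically forever; for $D/Q>1$ as in the claim, $\sqrt{D/Q}$ always has an expansion of this form. Convergents $r_k/s_k=[b_0,b_1,\ldots,b_k]$ are indexed from $k=0$ and written in lowest terms with $r_k,s_k\in\mathbb N$, $(r_k,s_k)=1$. The number $D_1$ is a natural number and is not a square. -}

module Defs where

open import Algebra.Definitions using (Invertible)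
open import Data.Integer as ℤ using (ℤ; +_; +0; +[1+_]; -[1+_])
open import Data.Nat as ℕ using (ℕ; zero; suc)
open import Data.Nat.Divisibility using (_∣_)
open import Data.Nat.DivMod using (_mod_)
open import Data.Product using (∃-syntax; ∃₂; _×_)
open import Data.Rational hiding (∣_∣)
open import Data.Sum using (_⊎_)
open import Data.Vec using (Vec; _∷ʳ_; lookup)
open import Function using (_∘_)
open import Level using (0ℓ)
open import Relation.Binary.PropositionalEquality using (_≡_)
open import Relation.Unary using (Pred)

-- A real number is given by its Dedekind cut: lower x p means p < x, and
-- upper x p means x < p.  The cut axioms are not fields, because only
-- square roots of nonnegative rationals and rational affine functions of
-- them are used, and for these the two predicates form a genuine cut.
record Cut : Set₁ where
  field
    lower : Pred ℚ 0ℓ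
    upper : Pred ℚ 0ℓ

open Cut public

-- The nonnegative square root of α, for α ≥ 0.
sqrt : ℚ → Cut
sqrt α .lower p = p < 0ℚ ⊎ p * p < α
sqrt α .upper p = 0ℚ < p × α < p * p

-- The real number a + c x.  Both endpoints of an interval l < x < u are
-- tested, so that the sign of c does not matter.
affine : ℚ → ℚ → Cut → Cut
affine a c x .lower p = ∃₂ λ l u → lower x l × upper x u × p < a + c * l × p < a + c * u
affine a c x .upper p = ∃₂ λ l u → lower x l × upper x u × a + c * l < p × a + c * u < p

infix 4 _⟶_ _HasExpansion_

-- The sequence v of rationals tends to x; the two memberships say that
-- v k - ε < x < v k + ε.
_⟶_ : (ℕ → ℚ) → Cut → Set
v ⟶ x = ∀ ε → 0ℚ < ε → ∃[ N ] ∀ k → N ℕ.≤ k → lower x (v k - ε) × upper x (v k + ε)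

-- The value at 0 is a convention; it is never taken in the convergents of
-- a sequence of positive partial quotients.
recip : ℚ → ℚ
recip (mkℚ +0 _ _)           = 0ℚ
recip p@(mkℚ +[1+ _ ] _ _)   = 1/ p
recip p@(mkℚ -[1+ _ ] _ _)   = 1/ p

-- [a 0, a 1, …, a k].  Elements of ℚ are in lowest terms, so r_k and s_k
-- are the numerator ↥ and the denominator ↧ of convergent a k.
convergent : (ℕ → ℕ) → ℕ → ℚ
convergent a zero    = + a 0 / 1
convergent a (suc k) = + a 0 / 1 + recip (convergent (a ∘ suc) k)

-- x = [a 0, a 1, a 2, …]
_HasExpansion_ : Cut → (ℕ → ℕ) → Set
x HasExpansion a = convergent a ⟶ x

-- The partial quotients of [b₀, {b₁, …, bₘ, 2b₀}], where bs = b₁, …, bₘ.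
periodic : ∀ {m} → ℕ → Vec ℕ m → ℕ → ℕ
periodic     b₀ bs zero    = b₀
periodic {m} b₀ bs (suc i) = lookup (bs ∷ʳ 2 ℕ.* b₀) (i mod suc m)

LeastDivisorWithSquareMultipleOf : ℕ → ℕ → Set
LeastDivisorWithSquareMultipleOf Q q =
  (q ∣ Q × Q ∣ q ℕ.^ 2) × (∀ d → d ∣ Q → Q ∣ d ℕ.^ 2 → q ℕ.≤ d)

-- r +√ s stands for r + s √d.  When d is not a square, r and s are
-- determined by this number, so propositional equality is the right one.
record ℤ[√_] (d : ℕ) : Set where
  constructor _+√_
  field
    re : ℤ
    im : ℤ

infix 5 _+√_

one : ∀ {d} → ℤ[√ d ]
one = + 1 +√ + 0

infixl 7 _·_

_·_ : ∀ {d} → ℤ[√ d ] → ℤ[√ d ] → ℤ[√ d ]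
_·_ {d} (r +√ s) (r′ +√ s′) =
  (r ℤ.* r′ ℤ.+ + d ℤ.* (s ℤ.* s′)) +√ (r ℤ.* s′ ℤ.+ s ℤ.* r′)

IsUnit : ∀ {d} → ℤ[√ d ] → Set
IsUnit = Invertible _≡_ one _·_

toReal : ∀ {d} → ℤ[√ d ] → Cut
toReal {d} (r +√ s) = affine (r / 1) (s / 1) (sqrt (+ d / 1))

infix 4 _,_over_IsPairOf_

-- (r / t , sq / t) = (↥ c , ↧ c), with the two exact divisions by t ≠ 0
-- cleared.
_,_over_IsPairOf_ : ℤ → ℤ → ℤ → ℚ → Set
r , sq over t IsPairOf c = r ≡ t ℤ.* ↥ c × sq ≡ t ℤ.* ↧ c

module Submission where

-- Put F(x , y) = Q x² - D y² and let v₋₂ = (0 , 1), v₋₁ = (1 , 0), v₀, v₁, …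
-- be the convergents.  As F changes sign from each vₖ to the next, vₖ and
-- vₖ₊₂ lie on the same side of √(D/Q), and the identity
-- g(v , w)² = F(v) F(w) + Q D det(v , w)² for the polar form g shows that
-- |F| > Q at every integer vector strictly between them.  So a primitive
-- positive vector with |F| ≤ Q is a convergent; a unit r + s √D₁ gives
-- F(r/t , sq/t) = ± Q/t².
--
-- Moving by one period is a linear map N.  The form H(v) = det(v , N v) is
-- invariant under N up to sign and F is bounded on convergents, so on the
-- vectors Nʲ v₋₁ the combination of F and H that is divisible by y is
-- bounded.  As y tends to infinity there, its linear cofactor vanishes.
-- Thus N is multiplication by a number A + c √(D/Q) of norm ± 1.  Since Q
-- divides c, this is a unit of ℤ[√D₁] whose rational part is prime to q.

open import Defs

module ContinuedFractions where

  open import Data.Empty using (⊥-elim)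
  open import Data.Integer hiding (suc; sign)
  open import Data.Integer.Divisibility.Signed using (∣ᵤ⇒∣; ∣⇒∣ᵤ; ∣m∣n⇒∣m-n; ∣m⇒∣m*n; ∣n⇒∣m*n; ∣-refl)
  open import Data.Integer.Properties
  open import Data.Integer.Tactic.RingSolver using (solve-∀)
  open import Data.Nat as ℕ using (ℕ; zero; suc; s≤s; z≤n)
  open import Data.Nat.Coprimality using (Coprime)
  import Data.Nat.Divisibility as ℕ
  import Data.Nat.Properties as ℕ
  open import Data.Product using (_,_; _×_; proj₁; proj₂; ∃-syntax)
  open import Data.Sum using (_⊎_; inj₁; inj₂)
  open import Function using (_∘_)
  open import Relation.Binary.Definitions using (tri<; tri≈; tri>)
  open import Relation.Binary.PropositionalEquality
  open import Relation.Nullary using (¬_)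

  -- Inequalities between integers.

  *-pos : ∀ {i j} → 0ℤ < i → 0ℤ < j → 0ℤ < i * j
  *-pos {+ suc _} {+ suc _} _ _ = +<+ (s≤s z≤n)
  *-pos {+ zero} (+<+ ()) _
  *-pos {+ suc _} {+ zero} _ (+<+ ())

  *-nonNeg : ∀ {i j} → 0ℤ ≤ i → 0ℤ ≤ j → 0ℤ ≤ i * j
  *-nonNeg {+ m} {+ n} _ _ = subst (0ℤ ≤_) (pos-* m n) (+≤+ z≤n)

  i*i-nonNeg : ∀ i → 0ℤ ≤ i * i
  i*i-nonNeg (+ m)    = *-nonNeg {+ m} {+ m} (+≤+ z≤n) (+≤+ z≤n)
  i*i-nonNeg -[1+ m ] = +≤+ z≤n

  pos-cancelˡ : ∀ {i j} → 0ℤ ≤ i → 0ℤ < i * j → 0ℤ < j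
  pos-cancelˡ {i@(+ _)} {j} _ p = *-cancelˡ-<-nonNeg i (subst (_< i * j) (sym (*-zeroʳ i)) p)

  pos-cancelʳ : ∀ {i j} → 0ℤ ≤ j → 0ℤ < i * j → 0ℤ < i
  pos-cancelʳ {i} {j} 0≤j p = pos-cancelˡ {j} {i} 0≤j (subst (0ℤ <_) (*-comm i j) p)

  <⇒0<j-i : ∀ {i j} → i < j → 0ℤ < j - i
  <⇒0<j-i {i} {j} i<j = subst (_< j - i) (+-inverseʳ i) (+-monoˡ-< (- i) i<j)

  0<j-i⇒< : ∀ {i j} → 0ℤ < j - i → i < j
  0<j-i⇒< {i} {j} p = subst₂ _<_ (+-identityˡ i) (lemma j i) (+-monoˡ-< i p)
    where
    lemma : ∀ j i → j - i + i ≡ j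
    lemma = solve-∀

  -- The form `Q x² - D y²` at combinations of two vectors.

  form : ℤ → ℤ → ℤ → ℤ → ℤ
  form D Q x y = Q * (x * x) - D * (y * y)

  polar : ℤ → ℤ → ℤ → ℤ → ℤ → ℤ → ℤ
  polar D Q x y x′ y′ = Q * (x * x′) - D * (y * y′)

  det : ℤ → ℤ → ℤ → ℤ → ℤ
  det x y x′ y′ = x * y′ - x′ * y

  -- The Gram determinant of two vectors is the determinant `- Q D` of the form times the square of
  -- `det`.
  polar² : ∀ D Q x y x′ y′ →
    (Q * (x * x′) - D * (y * y′)) * (Q * (x * x′) - D * (y * y′)) ≡
    (Q * (x * x) - D * (y * y)) * (Q * (x′ * x′) - D * (y′ * y′)) + Q * D * ((x * y′ - x′ * y) * (x * y′ - x′ * y))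
  polar² = solve-∀

  form-combination : ∀ D Q x y x′ y′ A B →
    Q * ((A * x + B * x′) * (A * x + B * x′)) - D * ((A * y + B * y′) * (A * y + B * y′)) ≡
    A * A * (Q * (x * x) - D * (y * y)) + + 2 * (A * B) * (Q * (x * x′) - D * (y * y′)) + B * B * (Q * (x′ * x′) - D * (y′ * y′))
  form-combination = solve-∀

  -- `D` and `Q` are left unordered, so that the results also serve with the two exchanged, for
  -- vectors below the root.
  module _ (D Q C : ℤ) (0≤D : 0ℤ ≤ D) (0≤Q : 0ℤ ≤ Q) (0≤C : 0ℤ ≤ C) (C²≤QD : C * C ≤ Q * D) where

    -- The product of the polar form with the nonnegative `Q x x′ + D y y′` is `F Q x′² + D y² F′`,
    -- whose first term is positive because `Q x′² ≥ F′`.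
    polar-pos : ∀ {x y x′ y′} → 0ℤ ≤ x → 0ℤ ≤ y → 0ℤ ≤ x′ → 0ℤ ≤ y′ →
      0ℤ < form D Q x y → 0ℤ < form D Q x′ y′ → 0ℤ < polar D Q x y x′ y′
    polar-pos {x} {y} {x′} {y′} 0≤x 0≤y 0≤x′ 0≤y′ 0<F 0<F′ =
      pos-cancelʳ (+-mono-≤ (*-nonNeg 0≤Q (*-nonNeg 0≤x 0≤x′)) (*-nonNeg 0≤D (*-nonNeg 0≤y 0≤y′)))
        (subst (0ℤ <_) (identity D Q x y x′ y′)
          (+-mono-<-≤ (*-pos 0<F 0<Qx′²) (*-nonNeg (*-nonNeg 0≤D (i*i-nonNeg y)) (<⇒≤ 0<F′))))
      where
      identity : ∀ D Q x y x′ y′ →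
        (Q * (x * x) - D * (y * y)) * (Q * (x′ * x′)) + D * (y * y) * (Q * (x′ * x′) - D * (y′ * y′)) ≡
        (Q * (x * x′) - D * (y * y′)) * (Q * (x * x′) + D * (y * y′))
      identity = solve-∀
      cancel : ∀ Q D x y → Q * (x * x) - D * (y * y) + D * (y * y) ≡ Q * (x * x)
      cancel = solve-∀
      0<Qx′² : 0ℤ < Q * (x′ * x′)
      0<Qx′² = subst (0ℤ <_) (cancel Q D x′ y′) (+-mono-<-≤ 0<F′ (*-nonNeg 0≤D (i*i-nonNeg y′)))

    -- a² F(X , Y) = A² F + 2 A B g + B² F′ where g is the polar form.  Here
    -- g > C a because g² = F F′ + Q D a², and 2 A B ≥ A + B ≥ a.
    form>C : ∀ {x y x′ y′ X Y a A B} → 0ℤ ≤ x → 0ℤ ≤ y → 0ℤ ≤ x′ → 0ℤ ≤ y′ →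
      0ℤ < form D Q x y → 0ℤ < form D Q x′ y′ →
      0ℤ < a → det x y x′ y′ * det x y x′ y′ ≡ a * a →
      1ℤ ≤ A → 1ℤ ≤ B → a ≤ A + B →
      a * X ≡ A * x + B * x′ → a * Y ≡ A * y + B * y′ →
      C < form D Q X Y
    form>C {x} {y} {x′} {y′} {X} {Y} {a} {A} {B} 0≤x 0≤y 0≤x′ 0≤y′ 0<F 0<F′ 0<a det²≡a² 1≤A 1≤B a≤A+B aX aY =
      0<j-i⇒< (pos-cancelˡ (i*i-nonNeg a) (subst (0ℤ <_) (sym expand)
        (+-mono-<-≤
          (+-mono-< (+-mono-< (*-pos 0<A² 0<F) (*-pos (*-pos {+ 2} (+<+ (s≤s z≤n)) (*-pos 0<A 0<B)) 0<g-Ca)) (*-pos 0<B² 0<F′))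
          (*-nonNeg (*-nonNeg (<⇒≤ 0<a) 0≤C) 0≤2AB-a))))
      where
      g = polar D Q x y x′ y′
      F = form D Q x y
      F′ = form D Q x′ y′
      0<A : 0ℤ < A
      0<A = <-≤-trans (+<+ (s≤s z≤n)) 1≤A
      0<B : 0ℤ < B
      0<B = <-≤-trans (+<+ (s≤s z≤n)) 1≤B
      0<A² = *-pos 0<A 0<A
      0<B² = *-pos 0<B 0<B
      0<g = polar-pos 0≤x 0≤y 0≤x′ 0≤y′ 0<F 0<F′
      difference : ∀ g C a → g * g - C * a * (C * a) ≡ (g - C * a) * (g + C * a)
      difference = solve-∀
      g² : g * g ≡ F * F′ + Q * D * (a * a)
      g² = trans (polar² D Q x y x′ y′) (cong (λ z → F * F′ + Q * D * z) det²≡a²)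
      regroup : ∀ f q C a → f + q * (a * a) - C * a * (C * a) ≡ f + (q - C * C) * (a * a)
      regroup = solve-∀
      0<g-Ca : 0ℤ < g - C * a
      0<g-Ca = pos-cancelʳ (+-mono-≤ (<⇒≤ 0<g) (*-nonNeg 0≤C (<⇒≤ 0<a)))
        (subst (0ℤ <_)
          (trans (sym (regroup (F * F′) (Q * D) C a))
            (trans (cong (_- C * a * (C * a)) (sym g²)) (difference g C a)))
          (+-mono-<-≤ (*-pos 0<F 0<F′) (*-nonNeg (i≤j⇒0≤j-i C²≤QD) (i*i-nonNeg a))))
      rearrange : ∀ A B a →
        (A - 1ℤ) * (B - 1ℤ) + (A - 1ℤ) * (B - 1ℤ) + ((A - 1ℤ) + (B - 1ℤ)) + (A + B - a) ≡ + 2 * (A * B) - a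
      rearrange = solve-∀
      0≤2AB-a : 0ℤ ≤ + 2 * (A * B) - a
      0≤2AB-a = subst (0ℤ ≤_) (rearrange A B a)
        (+-mono-≤ (+-mono-≤ (+-mono-≤ AB AB) (+-mono-≤ (i≤j⇒0≤j-i 1≤A) (i≤j⇒0≤j-i 1≤B))) (i≤j⇒0≤j-i a≤A+B))
        where AB = *-nonNeg (i≤j⇒0≤j-i 1≤A) (i≤j⇒0≤j-i 1≤B)
      scale : ∀ D Q X Y a C → a * a * (Q * (X * X) - D * (Y * Y) - C) ≡
        Q * (a * X * (a * X)) - D * (a * Y * (a * Y)) - a * a * C
      scale = solve-∀
      collect : ∀ F F′ g A B a C →
        A * A * F + + 2 * (A * B) * g + B * B * F′ - a * a * C ≡
        A * A * F + + 2 * (A * B) * (g - C * a) + B * B * F′ + a * C * (+ 2 * (A * B) - a)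
      collect = solve-∀
      expand : a * a * (form D Q X Y - C) ≡
        A * A * F + + 2 * (A * B) * (g - C * a) + B * B * F′ + a * C * (+ 2 * (A * B) - a)
      expand = trans (scale D Q X Y a C)
        (trans (cong₂ (λ X Y → Q * (X * X) - D * (Y * Y) - a * a * C) aX aY)
          (trans (cong (_- a * a * C) (form-combination D Q x y x′ y′ A B)) (collect F F′ g A B a C)))

  -- Continuants.

  -- A common divisor of `x` and `y` divides the determinant. The determinant may also be a norm,
  -- that of the vectors `(ρ , σ)` and `(d σ , ρ)`.
  ∣det∣≡1⇒coprime : ∀ x y x′ y′ → ∣ det x y x′ y′ ∣ ≡ 1 → Coprime ∣ x ∣ ∣ y ∣
  ∣det∣≡1⇒coprime x y x′ y′ ∣det∣≡1 {d} (d∣x , d∣y) =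
    ℕ.∣1⇒≡1 (subst (d ℕ.∣_) ∣det∣≡1
      (∣⇒∣ᵤ {+ d} (∣m∣n⇒∣m-n (∣m⇒∣m*n y′ (∣ᵤ⇒∣ {+ d} {x} d∣x)) (∣n⇒∣m*n x′ (∣ᵤ⇒∣ {+ d} {y} d∣y)))))

  -- (num a (suc k) , den a (suc k)) is the k-th convergent; index 0 is the
  -- customary (1 , 0) preceding it.
  num den : (ℕ → ℕ) → ℕ → ℤ
  num a zero    = 1ℤ
  num a (suc k) = + a 0 * num (a ∘ suc) k + den (a ∘ suc) k
  den a zero    = 0ℤ
  den a (suc k) = num (a ∘ suc) k

  num-cong : ∀ {a b} → (∀ i → a i ≡ b i) → ∀ k → num a k ≡ num b k
  den-cong : ∀ {a b} → (∀ i → a i ≡ b i) → ∀ k → den a k ≡ den b k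
  num-cong a≗b zero    = refl
  num-cong a≗b (suc k) =
    cong₂ _+_ (cong₂ (λ m n → + m * n) (a≗b 0) (num-cong (a≗b ∘ suc) k)) (den-cong (a≗b ∘ suc) k)
  den-cong a≗b zero    = refl
  den-cong a≗b (suc k) = num-cong (a≗b ∘ suc) k

  -- Associativity of the product of the matrices `(a j , 1 ; 1 , 0)`: the matrix of the first
  -- `suc i` quotients acts on the convergents of the remaining sequence.
  num-+ : ∀ a i k → num a (suc i ℕ.+ k) ≡
    num a (suc i) * num (a ∘ (suc i ℕ.+_)) k + num a i * den (a ∘ (suc i ℕ.+_)) k
  den-+ : ∀ a i k → den a (suc i ℕ.+ k) ≡
    den a (suc i) * num (a ∘ (suc i ℕ.+_)) k + den a i * den (a ∘ (suc i ℕ.+_)) k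
  num-+ a zero k = identity (+ a 0) (num (a ∘ suc) k) (den (a ∘ suc) k)
    where
    identity : ∀ c n d → c * n + d ≡ (c * 1ℤ + 0ℤ) * n + 1ℤ * d
    identity = solve-∀
  num-+ a (suc i) k = trans
    (cong₂ (λ n d → + a 0 * n + d) (num-+ (a ∘ suc) i k) (den-+ (a ∘ suc) i k))
    (identity (+ a 0) (num (a ∘ suc) (suc i)) (num (a ∘ suc) i) (den (a ∘ suc) (suc i)) (den (a ∘ suc) i) _ _)
    where
    identity : ∀ c n n′ d d′ x y → c * (n * x + n′ * y) + (d * x + d′ * y) ≡ (c * n + d) * x + (c * n′ + d′) * y
    identity = solve-∀
  den-+ a zero    k = identity (num (a ∘ suc) k) (den (a ∘ suc) k)
    where
    identity : ∀ n d → n ≡ 1ℤ * n + 0ℤ * d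
    identity = solve-∀
  den-+ a (suc i) k = num-+ (a ∘ suc) i k

  -- The definitions peel off the first quotient; this is the classical recurrence, which appends a
  -- quotient at the far end.
  num-rec : ∀ a k → num a (2 ℕ.+ k) ≡ num a k + + a (suc k) * num a (suc k)
  den-rec : ∀ a k → den a (2 ℕ.+ k) ≡ den a k + + a (suc k) * den a (suc k)
  num-rec a zero = identity (+ a 0) (+ a 1)
    where
    identity : ∀ b c → b * (c * 1ℤ + 0ℤ) + 1ℤ ≡ 1ℤ + c * (b * 1ℤ + 0ℤ)
    identity = solve-∀
  num-rec a (suc k) = trans
    (cong₂ (λ n d → + a 0 * n + d) (num-rec (a ∘ suc) k) (den-rec (a ∘ suc) k))
    (identity (+ a 0) (+ a (2 ℕ.+ k)) (num (a ∘ suc) k) (num (a ∘ suc) (suc k)) (den (a ∘ suc) k) (den (a ∘ suc) (suc k)))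
    where
    identity : ∀ b c n n′ d d′ → b * (n + c * n′) + (d + c * d′) ≡ b * n + d + c * (b * n′ + d′)
    identity = solve-∀
  den-rec a zero    = +-comm (+ a 1 * 1ℤ) 0ℤ
  den-rec a (suc k) = num-rec (a ∘ suc) k

  sign : ℕ → ℤ
  sign zero    = 1ℤ
  sign (suc k) = - sign k

  sign² : ∀ k → sign k * sign k ≡ 1ℤ
  sign² zero    = refl
  sign² (suc k) = trans (identity (sign k)) (sign² k)
    where
    identity : ∀ s → - s * - s ≡ s * s
    identity = solve-∀

  ∣sign∣ : ∀ k → ∣ sign k ∣ ≡ 1
  ∣sign∣ zero    = refl
  ∣sign∣ (suc k) = trans (∣-i∣≡∣i∣ (sign k)) (∣sign∣ k)

  sign-cases : ∀ k → sign k ≡ 1ℤ ⊎ sign k ≡ - 1ℤ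
  sign-cases zero    = inj₁ refl
  sign-cases (suc k) with sign-cases k
  ... | inj₁ eq = inj₂ (cong -_ eq)
  ... | inj₂ eq = inj₁ (cong -_ eq)

  -- Prepending a quotient applies a matrix of determinant `-1` to both vectors.
  det-convergents : ∀ a k → det (num a k) (den a k) (num a (suc k)) (den a (suc k)) ≡ sign k
  det-convergents a zero = identity (+ a 0)
    where
    identity : ∀ c → 1ℤ * 1ℤ - (c * 1ℤ + 0ℤ) * 0ℤ ≡ 1ℤ
    identity = solve-∀
  det-convergents a (suc k) = trans
    (identity (+ a 0) (num (a ∘ suc) k) (den (a ∘ suc) k) (num (a ∘ suc) (suc k)) (den (a ∘ suc) (suc k)))
    (cong -_ (det-convergents (a ∘ suc) k))
    where
    identity : ∀ c n d n′ d′ → (c * n + d) * n′ - (c * n′ + d′) * n ≡ - (n * d′ - n′ * d)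
    identity = solve-∀

  num-den-coprime : ∀ a k → Coprime ∣ num a k ∣ ∣ den a k ∣
  num-den-coprime a k = ∣det∣≡1⇒coprime (num a k) (den a k) (num a (suc k)) (den a (suc k))
    (trans (cong ∣_∣ (det-convergents a k)) (∣sign∣ k))

  *-pos-≥ : ∀ {i j} → 1ℤ ≤ i → 1ℤ ≤ j → j ≤ i * j
  *-pos-≥ {i} {j} 1≤i 1≤j = subst (_≤ i * j) (*-identityˡ j)
    (*-monoʳ-≤-nonNeg j {{nonNegative (≤-trans (+≤+ z≤n) 1≤j)}} 1≤i)

  num≥1 : ∀ a → (∀ i → 1 ℕ.≤ a i) → ∀ k → 1ℤ ≤ num a k
  den≥0 : ∀ a → (∀ i → 1 ℕ.≤ a i) → ∀ k → 0ℤ ≤ den a k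
  num≥1 a 1≤a zero    = ≤-refl
  num≥1 a 1≤a (suc k) = +-mono-≤
    (≤-trans (num≥1 (a ∘ suc) (1≤a ∘ suc) k) (*-pos-≥ (+≤+ (1≤a 0)) (num≥1 (a ∘ suc) (1≤a ∘ suc) k)))
    (den≥0 (a ∘ suc) (1≤a ∘ suc) k)
  den≥0 a 1≤a zero    = ≤-refl
  den≥0 a 1≤a (suc k) = ≤-trans (+≤+ z≤n) (num≥1 (a ∘ suc) (1≤a ∘ suc) k)

  -- Each step adds at least the earlier numerator, hence at least `1`. Linear growth is enough to
  -- make the denominators unbounded.
  num-growth : ∀ a → (∀ i → 1 ℕ.≤ a i) → ∀ k → + k ≤ num a k
  num-growth a 1≤a zero          = +≤+ z≤n
  num-growth a 1≤a (suc zero)    = num≥1 a 1≤a 1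
  num-growth a 1≤a (suc (suc k)) = subst (_ ≤_) (sym (num-rec a k))
    (+-mono-≤ (num≥1 a 1≤a k)
      (≤-trans (num-growth a 1≤a (suc k)) (*-pos-≥ (+≤+ (1≤a (suc k))) (num≥1 a 1≤a (suc k)))))

  -- Primitive vectors with a small value of the form are convergents.

  Small : ℤ → ℤ → Set
  Small Q i = - Q ≤ i × i ≤ Q

  -- The integral content of the expansion: the vectors lie alternately on the two sides of
  -- `√(D/Q)`, beginning with `(1 , 0)` above it.
  Alternating : ℤ → ℤ → (ℕ → ℕ) → Set
  Alternating D Q a = ∀ k → 0ℤ < sign k * form D Q (num a k) (den a k)

  *-pos⁻¹ : ∀ {i j} → 0ℤ < i * j → (0ℤ < i × 0ℤ < j) ⊎ (0ℤ < - i × 0ℤ < - j)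
  *-pos⁻¹ {+ m}      {j}        p = inj₁ (pos-cancelʳ (<⇒≤ (pos-cancelˡ {+ m} (+≤+ z≤n) p)) p , pos-cancelˡ {+ m} (+≤+ z≤n) p)
  *-pos⁻¹ { -[1+ m ]} {+ suc n}  ()
  *-pos⁻¹ { -[1+ m ]} {+ zero}   p = ⊥-elim (<-irrefl (sym (*-zeroʳ -[1+ m ])) p)
  *-pos⁻¹ { -[1+ m ]} { -[1+ n ]} p = inj₂ (+<+ (s≤s z≤n) , +<+ (s≤s z≤n))

  form-swap : ∀ D Q x y → Q * (x * x) - D * (y * y) ≡ - (D * (y * y) - Q * (x * x))
  form-swap = solve-∀

  module _ {D Q : ℤ} (0≤Q : 0ℤ ≤ Q) (Q≤D : Q ≤ D) where

    private
      0≤D : 0ℤ ≤ D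
      0≤D = ≤-trans 0≤Q Q≤D

      Q²≤QD : Q * Q ≤ Q * D
      Q²≤QD = *-monoˡ-≤-nonNeg Q {{nonNegative 0≤Q}} Q≤D

    -- The two vectors lie on the same side of `√(D/Q)`. Above it `form>C` applies directly, below
    -- it after exchanging the coordinates together with `D` and `Q`. The constant is `Q` both
    -- times, since `Q ≤ D` gives `Q² ≤ Q D`.
    ¬small-form : ∀ {x y x′ y′ X Y a A B} → 0ℤ ≤ x → 0ℤ ≤ y → 0ℤ ≤ x′ → 0ℤ ≤ y′ →
      0ℤ < form D Q x y * form D Q x′ y′ →
      0ℤ < a → det x y x′ y′ * det x y x′ y′ ≡ a * a →
      1ℤ ≤ A → 1ℤ ≤ B → a ≤ A + B →
      a * X ≡ A * x + B * x′ → a * Y ≡ A * y + B * y′ →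
      ¬ Small Q (form D Q X Y)
    ¬small-form {x} {y} {x′} {y′} {X} {Y} 0≤x 0≤y 0≤x′ 0≤y′ 0<FF′ 0<a det² 1≤A 1≤B a≤A+B aX aY (-Q≤F , F≤Q)
      with *-pos⁻¹ 0<FF′
    ... | inj₁ (0<F , 0<F′) = <-irrefl refl (<-≤-trans
            (form>C D Q Q 0≤D 0≤Q 0≤Q Q²≤QD 0≤x 0≤y 0≤x′ 0≤y′ 0<F 0<F′ 0<a det² 1≤A 1≤B a≤A+B aX aY) F≤Q)
    ... | inj₂ (0<-F , 0<-F′) = <-irrefl refl (<-≤-trans
            (neg-mono-< (form>C Q D Q 0≤Q 0≤D 0≤Q (subst (Q * Q ≤_) (*-comm Q D) Q²≤QD) 0≤y 0≤x 0≤y′ 0≤x′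
              (subst (0ℤ <_) (sym (form-swap Q D y x)) 0<-F) (subst (0ℤ <_) (sym (form-swap Q D y′ x′)) 0<-F′)
              0<a (trans (identity x y x′ y′) det²) 1≤A 1≤B a≤A+B aY aX))
            (subst (- Q ≤_) (form-swap D Q X Y) -Q≤F))
      where
      identity : ∀ x y x′ y′ → (y * x′ - y′ * x) * (y * x′ - y′ * x) ≡ (x * y′ - x′ * y) * (x * y′ - x′ * y)
      identity = solve-∀

    -- Otherwise (X , Y) would lie strictly between (x , y) and (x″ , y″).
    quotient-bound : ∀ {x y x′ y′ x″ y″ X Y} a P R → 0ℤ ≤ x → 0ℤ ≤ y → 0ℤ ≤ x″ → 0ℤ ≤ y″ →
      det x y x′ y′ * det x y x′ y′ ≡ 1ℤ → 1ℤ ≤ a →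
      x″ ≡ x + a * x′ → y″ ≡ y + a * y′ →
      0ℤ < form D Q x y * form D Q x″ y″ →
      1ℤ ≤ P → 1ℤ ≤ R → X ≡ P * x + R * x′ → Y ≡ P * y + R * y′ →
      Small Q (form D Q X Y) → a * P ≤ R
    quotient-bound {x} {y} {x′} {y′} a P R 0≤x 0≤y 0≤x″ 0≤y″ det²≡1 1≤a refl refl 0<FF″ 1≤P 1≤R refl refl small
      with <-cmp R (a * P)
    ... | tri≈ _ R≡aP _ = ≤-reflexive (sym R≡aP)
    ... | tri> _ _ aP<R = <⇒≤ aP<R
    -- Here `a (X , Y) = (a P - R) (x , y) + R (x″ ,
    -- y″)`. Both coefficients are at least `1`, and their sum `a P` is at least `a`.
    ... | tri< R<aP _ _ = ⊥-elim (¬small-form {a = a} {A = a * P - R} {B = R} 0≤x 0≤y 0≤x″ 0≤y″ 0<FF″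
            (<-≤-trans (+<+ (s≤s z≤n)) 1≤a)
            (trans (det-scale a x y x′ y′) (trans (cong (a * a *_) det²≡1) (*-identityʳ (a * a))))
            (i<j⇒suc[i]≤j (<⇒0<j-i R<aP)) 1≤R (subst (a ≤_) (identity a P R) (subst (_≤ a * P) (*-identityʳ a)
              (*-monoˡ-≤-nonNeg a {{nonNegative (≤-trans (+≤+ z≤n) 1≤a)}} 1≤P)))
            (combination a P R x x′) (combination a P R y y′) small)
      where
      det-scale : ∀ a x y x′ y′ →
        (x * (y + a * y′) - (x + a * x′) * y) * (x * (y + a * y′) - (x + a * x′) * y) ≡
        a * a * ((x * y′ - x′ * y) * (x * y′ - x′ * y))
      det-scale = solve-∀
      identity : ∀ a P R → a * P ≡ a * P - R + R
      identity = solve-∀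
      combination : ∀ a P R x x′ → a * (P * x + R * x′) ≡ (a * P - R) * x + R * (x + a * x′)
      combination = solve-∀

    module _ (a : ℕ → ℕ) (1≤a : ∀ i → 1 ℕ.≤ a i) (alternating : Alternating D Q a) where

      same-sign : ∀ k → 0ℤ < form D Q (num a k) (den a k) * form D Q (num a (2 ℕ.+ k)) (den a (2 ℕ.+ k))
      same-sign k = subst (0ℤ <_)
        (trans (identity (sign k) F F″) (trans (cong (_* (F * F″)) (sign² k)) (*-identityˡ (F * F″))))
        (*-pos (alternating k) (alternating (2 ℕ.+ k)))
        where
        F = form D Q (num a k) (den a k)
        F″ = form D Q (num a (2 ℕ.+ k)) (den a (2 ℕ.+ k))
        identity : ∀ s F F″ → s * F * (- - s * F″) ≡ s * s * (F * F″)
        identity = solve-∀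

      private
        0≤num : ∀ k → 0ℤ ≤ num a k
        0≤num k = ≤-trans (+≤+ z≤n) (num≥1 a 1≤a k)

        multiple : ∀ {X Y} P k → Coprime ∣ X ∣ ∣ Y ∣ → X ≡ + P * num a k → Y ≡ + P * den a k →
          X ≡ num a k × Y ≡ den a k
        multiple P k coprime refl refl
          with refl ← coprime {P} (∣⇒∣ᵤ (∣m⇒∣m*n {+ P} (num a k) ∣-refl) ,
                                   ∣⇒∣ᵤ (∣m⇒∣m*n {+ P} (den a k) ∣-refl)) =
          *-identityˡ (num a k) , *-identityˡ (den a k)

      -- The Euclidean algorithm on the coordinates of `(X , Y)` in the basis of two consecutive
      -- convergents. By `quotient-bound` the next quotient `c` satisfies `c P ≤ R`; with
      -- `R = c P + R′` the coordinates in the next basis are `R′` and `P`. Their sum, bounded by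
      -- `n`, drops until `R′ = 0`. Then `(X , Y)` is `P` times a convergent, and `P = 1` by
      -- primitivity.
      descend : ∀ n k P R {X Y} → P ℕ.+ R ℕ.≤ n → 1 ℕ.≤ P → 1 ℕ.≤ R → Coprime ∣ X ∣ ∣ Y ∣ →
        X ≡ + P * num a k + + R * num a (suc k) → Y ≡ + P * den a k + + R * den a (suc k) →
        Small Q (form D Q X Y) → ∃[ j ] X ≡ num a (suc j) × Y ≡ den a (suc j)
      descend zero k (suc P) R () 1≤P 1≤R coprime X≡ Y≡ small
      descend (suc n) k P R {X} {Y} P+R≤1+n 1≤P 1≤R coprime X≡ Y≡ small =
        next (proj₁ remainder) (rebase num (num-rec a k) X≡) (rebase den (den-rec a k) Y≡) bound
        where
        c = a (suc k)
        cP≤R : + c * + P ≤ + R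
        cP≤R = quotient-bound (+ c) (+ P) (+ R) (0≤num k) (den≥0 a 1≤a k) (0≤num (2 ℕ.+ k)) (den≥0 a 1≤a (2 ℕ.+ k))
          (trans (cong₂ _*_ (det-convergents a k) (det-convergents a k)) (sign² k)) (+≤+ (1≤a (suc k)))
          (num-rec a k) (den-rec a k) (same-sign k) (+≤+ 1≤P) (+≤+ 1≤R) X≡ Y≡ small
        remainder : ∃[ R′ ] c ℕ.* P ℕ.+ R′ ≡ R
        remainder = ℕ.m≤n⇒∃[o]m+o≡n (drop‿+≤+ (subst (_≤ + R) (sym (pos-* c P)) cP≤R))
        R≡ : + R ≡ + c * + P + + proj₁ remainder
        R≡ = trans (cong +_ (sym (proj₂ remainder)))
          (trans (pos-+ (c ℕ.* P) (proj₁ remainder)) (cong (_+ + proj₁ remainder) (pos-* c P)))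
        identity : ∀ c P R′ z z′ → P * z + (c * P + R′) * z′ ≡ R′ * z′ + P * (z + c * z′)
        identity = solve-∀
        rebase : ∀ (f : (ℕ → ℕ) → ℕ → ℤ) {Z} → f a (2 ℕ.+ k) ≡ f a k + + c * f a (suc k) →
          Z ≡ + P * f a k + + R * f a (suc k) →
          Z ≡ + proj₁ remainder * f a (suc k) + + P * f a (2 ℕ.+ k)
        rebase f rec Z≡ = trans Z≡ (trans (cong (λ z → + P * f a k + z * f a (suc k)) R≡)
          (trans (identity (+ c) (+ P) (+ proj₁ remainder) (f a k) (f a (suc k)))
            (cong (λ z → + proj₁ remainder * f a (suc k) + + P * z) (sym rec))))
        bound : proj₁ remainder ℕ.+ P ℕ.≤ n
        bound = ℕ.≤-pred (begin
          suc (proj₁ remainder ℕ.+ P)         ≡⟨ cong suc (ℕ.+-comm (proj₁ remainder) P) ⟩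
          suc (P ℕ.+ proj₁ remainder)         ≡⟨ ℕ.+-suc P (proj₁ remainder) ⟨
          P ℕ.+ suc (proj₁ remainder)         ≤⟨ ℕ.+-monoʳ-≤ P (ℕ.+-monoˡ-≤ (proj₁ remainder) (ℕ.*-mono-≤ (1≤a (suc k)) 1≤P)) ⟩
          P ℕ.+ (c ℕ.* P ℕ.+ proj₁ remainder) ≡⟨ cong (P ℕ.+_) (proj₂ remainder) ⟩
          P ℕ.+ R                             ≤⟨ P+R≤1+n ⟩
          suc n                               ∎)
          where open ℕ.≤-Reasoning
        next : ∀ R′ → X ≡ + R′ * num a (suc k) + + P * num a (2 ℕ.+ k) → Y ≡ + R′ * den a (suc k) + + P * den a (2 ℕ.+ k) →
          R′ ℕ.+ P ℕ.≤ n → ∃[ j ] X ≡ num a (suc j) × Y ≡ den a (suc j)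
        next zero X≡ Y≡ _ = suc k ,
          multiple P (2 ℕ.+ k) coprime (trans X≡ (drop (num a (suc k)) _)) (trans Y≡ (drop (den a (suc k)) _))
          where
          drop : ∀ x z → 0ℤ * x + z ≡ z
          drop = solve-∀
        next (suc R′) X≡ Y≡ bound = descend n (suc k) (suc R′) P bound (s≤s z≤n) 1≤P coprime X≡ Y≡ small

      -- The descent starts in the basis `(0 , 1)`, `(1 , 0)`, with coordinates `y` and `x`. As
      -- `(0 , 1)` is not a value of `num` and `den`, the first Euclidean step is done by hand; the
      -- form is `- D` at that vector.
      small-form⇒convergent : 0ℤ < D → ∀ x y → 1 ℕ.≤ x → 1 ℕ.≤ y → Coprime x y →
        Small Q (form D Q (+ x) (+ y)) → ∃[ j ] + x ≡ num a (suc j) × + y ≡ den a (suc j)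
      small-form⇒convergent 0<D x y 1≤x 1≤y coprime small =
        next (proj₁ remainder)
          (trans (cong +_ (sym (proj₂ remainder)))
            (trans (pos-+ (c ℕ.* y) (proj₁ remainder))
              (trans (cong (_+ + proj₁ remainder) (pos-* c y)) (identity₁ (+ c) (+ y) (+ proj₁ remainder)))))
          (identity₂ (+ y) (+ proj₁ remainder))
        where
        c = a 0
        u₁ = num a 1
        negative-start : ∀ D Q F → D * (- 1ℤ * F) ≡ (Q * (0ℤ * 0ℤ) - D * (1ℤ * 1ℤ)) * F
        negative-start = solve-∀
        first : ∀ x z → z + x * 0ℤ ≡ z
        first = solve-∀
        swap₁ : ∀ x y → x ≡ y * 0ℤ + x * 1ℤ
        swap₁ = solve-∀
        swap₂ : ∀ x y → y ≡ y * 1ℤ + x * 0ℤ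
        swap₂ = solve-∀
        cy≤x : + c * + y ≤ + x
        cy≤x = quotient-bound {x = 0ℤ} {1ℤ} {1ℤ} {0ℤ} {u₁} {1ℤ} (+ c) (+ y) (+ x)
          ≤-refl (+≤+ z≤n) (0≤num 1) (+≤+ z≤n) refl (+≤+ (1≤a 0))
          (+-comm (+ c * 1ℤ) 0ℤ) (sym (first (+ c) 1ℤ))
          (subst (0ℤ <_) (negative-start D Q (form D Q u₁ 1ℤ)) (*-pos 0<D (alternating 1)))
          (+≤+ 1≤y) (+≤+ 1≤x) (swap₁ (+ x) (+ y)) (swap₂ (+ x) (+ y)) small
        remainder : ∃[ R ] c ℕ.* y ℕ.+ R ≡ x
        remainder = ℕ.m≤n⇒∃[o]m+o≡n (drop‿+≤+ (subst (_≤ + x) (sym (pos-* c y)) cy≤x))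
        identity₁ : ∀ c y R → c * y + R ≡ R * 1ℤ + y * (c * 1ℤ + 0ℤ)
        identity₁ = solve-∀
        identity₂ : ∀ y R → y ≡ R * 0ℤ + y * 1ℤ
        identity₂ = solve-∀
        next : ∀ R → + x ≡ + R * 1ℤ + + y * u₁ → + y ≡ + R * 0ℤ + + y * 1ℤ →
          ∃[ j ] + x ≡ num a (suc j) × + y ≡ den a (suc j)
        next zero    x≡ y≡ = 0 , multiple y 1 coprime (trans x≡ (drop (+ y * u₁))) (trans y≡ (drop (+ y * 1ℤ)))
          where
          drop : ∀ z → 0ℤ + z ≡ z
          drop = solve-∀
        next (suc R) x≡ y≡ = descend (suc R ℕ.+ y) 0 (suc R) y ℕ.≤-refl (s≤s z≤n) 1≤y coprime x≡ y≡ small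

  -- The linear map of one period.

  0≤i≤n⇒∣i∣≤n : ∀ {i n} → 0ℤ ≤ i → i ≤ + n → ∣ i ∣ ℕ.≤ n
  0≤i≤n⇒∣i∣≤n {+ _} _ (+≤+ i≤n) = i≤n

  cramer : ∀ α β x y x′ y′ → α * x + β * y ≡ 0ℤ → α * x′ + β * y′ ≡ 0ℤ →
    α * det x y x′ y′ ≡ 0ℤ × β * det x y x′ y′ ≡ 0ℤ
  cramer α β x y x′ y′ ℓ≡0 ℓ′≡0 =
    trans (identity₁ α β x y x′ y′) (trans (cong₂ (λ l l′ → l * y′ - l′ * y) ℓ≡0 ℓ′≡0) (zeros y y′)) ,
    trans (identity₂ α β x y x′ y′) (trans (cong₂ (λ l l′ → l′ * x - l * x′) ℓ≡0 ℓ′≡0) (zeros x′ x))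
    where
    identity₁ : ∀ α β x y x′ y′ → α * (x * y′ - x′ * y) ≡ (α * x + β * y) * y′ - (α * x′ + β * y′) * y
    identity₁ = solve-∀
    identity₂ : ∀ α β x y x′ y′ → β * (x * y′ - x′ * y) ≡ (α * x′ + β * y′) * x - (α * x + β * y) * x′
    identity₂ = solve-∀
    zeros : ∀ x y → 0ℤ * y - 0ℤ * x ≡ 0ℤ
    zeros = solve-∀

  module _ (D Q : ℕ) (a : ℕ → ℕ) (alternating : Alternating (+ D) (+ Q) a) where

    -- Consecutive values have opposite signs, and their product is polar² - Q D.
    form-bounded : ∀ k → ∣ form (+ D) (+ Q) (num a k) (den a k) ∣ ℕ.≤ Q ℕ.* D
    form-bounded k = ℕ.≤-trans (ℕ.m≤m*n ∣ F ∣ ∣ F′ ∣ {{ℕ.≢-nonZero ∣F′∣≢0}})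
      (subst (ℕ._≤ Q ℕ.* D) (trans (∣-i∣≡∣i∣ (F * F′)) (abs-* F F′))
        (0≤i≤n⇒∣i∣≤n (<⇒≤ 0<-FF′) (subst (- (F * F′) ≤_) (sym (pos-* Q D)) (0≤i-j⇒j≤i (subst (0ℤ ≤_) g²≡ (i*i-nonNeg g))))))
      where
      x = num a k
      y = den a k
      x′ = num a (suc k)
      y′ = den a (suc k)
      F = form (+ D) (+ Q) x y
      F′ = form (+ D) (+ Q) x′ y′
      g = polar (+ D) (+ Q) x y x′ y′
      signs : ∀ s F F′ → s * F * (- s * F′) ≡ s * s * - (F * F′)
      signs = solve-∀
      0<-FF′ : 0ℤ < - (F * F′)
      0<-FF′ = subst (0ℤ <_)
        (trans (signs (sign k) F F′) (trans (cong (_* - (F * F′)) (sign² k)) (*-identityˡ (- (F * F′)))))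
        (*-pos (alternating k) (alternating (suc k)))
      ∣F′∣≢0 : ∣ F′ ∣ ≢ 0
      ∣F′∣≢0 eq = <-irrefl (sym (trans (cong (λ z → - (F * z)) (∣i∣≡0⇒i≡0 eq)) (cong -_ (*-zeroʳ F)))) 0<-FF′
      rearrange : ∀ f q → f + q * 1ℤ ≡ q - - f
      rearrange = solve-∀
      g²≡ : g * g ≡ + Q * + D - - (F * F′)
      g²≡ = trans (polar² (+ D) (+ Q) x y x′ y′)
        (trans (cong (λ z → F * F′ + + Q * + D * z) (trans (cong₂ _*_ (det-convergents a k) (det-convergents a k)) (sign² k)))
          (rearrange (F * F′) (+ Q * + D)))

  module Period (a : ℕ → ℕ) (m : ℕ) (a-end : a (suc m) ≡ 2 ℕ.* a 0) (a-periodic : ∀ i → a (suc m ℕ.+ suc i) ≡ a (suc i)) where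

    -- The matrix (A , b ; c , d) carries each convergent one period further.
    A b c d : ℤ
    A = num a (suc m)
    b = A * + a 0 + num a m
    c = den a (suc m)
    d = c * + a 0 + den a m

    private
      tail : ℕ → ℕ
      tail i = a (suc m ℕ.+ i)

      head-tail : + tail 0 ≡ + a 0 + + a 0
      head-tail = cong +_ (trans (cong a (ℕ.+-identityʳ (suc m))) (trans a-end (cong (a 0 ℕ.+_) (ℕ.+-identityʳ (a 0)))))

      -- After one period the sequence is `a` again with its first quotient doubled, so its
      -- convergents are those of `a` translated by `a 0`. The translation is absorbed into the
      -- second column of the matrix, whence the terms with `a 0` in `b` and `d`.
      step : ∀ A b k → A * num tail k + b * den tail k ≡ A * num a k + (A * + a 0 + b) * den a k
      step A b zero = identity A b (+ a 0)
        where
        identity : ∀ A b c → A * 1ℤ + b * 0ℤ ≡ A * 1ℤ + (A * c + b) * 0ℤ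
        identity = solve-∀
      step A b (suc k) = trans
        (cong₂ (λ x y → A * x + b * y) (cong₂ _+_ (cong₂ _*_ head-tail (num-cong a-periodic k)) (den-cong a-periodic k))
          (num-cong a-periodic k))
        (identity A b (+ a 0) (num (a ∘ suc) k) (den (a ∘ suc) k))
        where
        identity : ∀ A b c x y → A * ((c + c) * x + y) + b * x ≡ A * (c * x + y) + (A * c + b) * x
        identity = solve-∀

    num-period : ∀ k → num a (suc m ℕ.+ k) ≡ A * num a k + b * den a k
    num-period k = trans (num-+ a m k) (step A (num a m) k)

    den-period : ∀ k → den a (suc m ℕ.+ k) ≡ c * num a k + d * den a k
    den-period k = trans (den-+ a m k) (step c (den a m) k)

    ∣Ad-bc∣≡1 : ∣ A * d - b * c ∣ ≡ 1
    ∣Ad-bc∣≡1 = trans (cong ∣_∣ (trans (identity A (+ a 0) (num a m) c (den a m)) (cong -_ (det-convergents a m)))) (∣sign∣ (suc m))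
      where
      identity : ∀ A e n c k → A * (c * e + k) - (A * e + n) * c ≡ - (n * c - A * k)
      identity = solve-∀

    private
      -- For `N` the matrix of a period, `det (N v , N N v)` is the determinant of `N` times
      -- `det (v , N v)`.
      shift-form : ∀ A b c d x y →
        (A * x + b * y) * (c * (A * x + b * y) + d * (c * x + d * y)) - (A * (A * x + b * y) + b * (c * x + d * y)) * (c * x + d * y) ≡
        (A * d - b * c) * (x * (c * x + d * y) - (A * x + b * y) * y)
      shift-form = solve-∀

      H : ℕ → ℤ
      H k = det (num a k) (den a k) (num a (suc m ℕ.+ k)) (den a (suc m ℕ.+ k))

      H-expand : ∀ k → H k ≡ num a k * (c * num a k + d * den a k) - (A * num a k + b * den a k) * den a k
      H-expand k = cong₂ (λ x′ y′ → num a k * y′ - x′ * den a k) (num-period k) (den-period k)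

      H-shift : ∀ k → ∣ H (suc m ℕ.+ k) ∣ ≡ ∣ H k ∣
      H-shift k = trans (cong ∣_∣ (trans (H-expand (suc m ℕ.+ k))
          (trans (cong₂ (λ x y → x * (c * x + d * y) - (A * x + b * y) * y) (num-period k) (den-period k))
            (trans (shift-form A b c d (num a k) (den a k)) (cong ((A * d - b * c) *_) (sym (H-expand k)))))))
        (trans (abs-* (A * d - b * c) (H k)) (trans (cong (ℕ._* ∣ H k ∣) ∣Ad-bc∣≡1) (ℕ.*-identityˡ ∣ H k ∣)))

      -- At `(1 , 0)` the form `H` takes the value `c`, and `H-shift` carries its absolute value
      -- along whole periods.
      ∣H∣ : ∀ j → ∣ H (j ℕ.* suc m) ∣ ≡ ∣ c ∣
      ∣H∣ zero    = cong ∣_∣ (trans (H-expand 0) (identity A b c d))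
        where
        identity : ∀ A b c d → 1ℤ * (c * 1ℤ + d * 0ℤ) - (A * 1ℤ + b * 0ℤ) * 0ℤ ≡ c
        identity = solve-∀
      ∣H∣ (suc j) = trans (H-shift (j ℕ.* suc m)) (∣H∣ j)

    module _ (1≤a : ∀ i → 1 ℕ.≤ a i) (D Q : ℕ) .{{_ : ℕ.NonZero Q}} (alternating : Alternating (+ D) (+ Q) a) where

      private
        α β : ℤ
        α = + Q * (d - A)
        β = c * + D - + Q * b

        linear : ℕ → ℤ
        linear k = α * num a k + β * den a k

        -- The quadratic parts of Q H and c form cancel.
        eliminate : ∀ k → den a k * linear k ≡ + Q * H k - c * form (+ D) (+ Q) (num a k) (den a k)
        eliminate k = trans (identity (+ D) (+ Q) A b c d (num a k) (den a k))
          (cong (λ h → + Q * h - c * form (+ D) (+ Q) (num a k) (den a k)) (sym (H-expand k)))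
          where
          identity : ∀ D Q A b c d x y → y * (Q * (d - A) * x + (c * D - Q * b) * y) ≡
            Q * (x * (c * x + d * y) - (A * x + b * y) * y) - c * (Q * (x * x) - D * (y * y))
          identity = solve-∀

        bound : ℕ
        bound = Q ℕ.* ∣ c ∣ ℕ.+ ∣ c ∣ ℕ.* (Q ℕ.* D)

        -- At whole periods both terms of `eliminate` are bounded: `H` is `c` up to sign, and the
        -- form is at most `Q D` in absolute value.
        linear-bounded : ∀ j → ∣ den a (j ℕ.* suc m) ∣ ℕ.* ∣ linear (j ℕ.* suc m) ∣ ℕ.≤ bound
        linear-bounded j = begin
          ∣ den a k ∣ ℕ.* ∣ linear k ∣       ≡⟨ abs-* (den a k) (linear k) ⟨
          ∣ den a k * linear k ∣             ≡⟨ cong ∣_∣ (eliminate k) ⟩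
          ∣ + Q * H k - c * F ∣              ≤⟨ ∣i-j∣≤∣i∣+∣j∣ (+ Q * H k) (c * F) ⟩
          ∣ + Q * H k ∣ ℕ.+ ∣ c * F ∣        ≡⟨ cong₂ ℕ._+_ (abs-* (+ Q) (H k)) (abs-* c F) ⟩
          Q ℕ.* ∣ H k ∣ ℕ.+ ∣ c ∣ ℕ.* ∣ F ∣  ≡⟨ cong (λ h → Q ℕ.* h ℕ.+ ∣ c ∣ ℕ.* ∣ F ∣) (∣H∣ j) ⟩
          Q ℕ.* ∣ c ∣ ℕ.+ ∣ c ∣ ℕ.* ∣ F ∣    ≤⟨ ℕ.+-monoʳ-≤ (Q ℕ.* ∣ c ∣) (ℕ.*-monoʳ-≤ ∣ c ∣ (form-bounded D Q a alternating k)) ⟩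
          bound                              ∎
          where
          open ℕ.≤-Reasoning
          k = j ℕ.* suc m
          F = form (+ D) (+ Q) (num a k) (den a k)

        den-growth : ∀ j → j ℕ.≤ ∣ den a (suc j ℕ.* suc m) ∣
        den-growth j = ℕ.≤-trans (ℕ.≤-trans (ℕ.m≤m*n j (suc m)) (ℕ.m≤n+m (j ℕ.* suc m) m))
          (≤⇒∣∣ (num-growth (a ∘ suc) (1≤a ∘ suc) (m ℕ.+ j ℕ.* suc m)))
          where
          ≤⇒∣∣ : ∀ {n i} → + n ≤ i → n ℕ.≤ ∣ i ∣
          ≤⇒∣∣ (+≤+ n≤i) = n≤i

        -- A nonzero integer times a denominator exceeding `bound` would violate `linear-bounded`.
        linear-vanishes : ∀ j → bound ℕ.< j → linear (suc j ℕ.* suc m) ≡ 0ℤ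
        linear-vanishes j bound<j = ∣i∣≡0⇒i≡0 (small (linear-bounded (suc j)))
          where
          small : ∀ {n} → ∣ den a (suc j ℕ.* suc m) ∣ ℕ.* n ℕ.≤ bound → n ≡ 0
          small {zero}  _ = refl
          small {suc n} p = ⊥-elim (ℕ.<⇒≱ bound<j (ℕ.≤-trans (den-growth j) (ℕ.≤-trans (ℕ.m≤m*n _ (suc n)) p)))

        -- The linear form vanishes at index `K` and one period later. The determinant of these two
        -- vectors is `H K`, of absolute value `∣ c ∣ ≥ 1`, so by Cramer's rule both coefficients
        -- are zero.
        K : ℕ
        K = suc (suc bound) ℕ.* suc m

        0<∣H∣ : H K ≢ 0ℤ
        0<∣H∣ eq = 1≰0 (subst (1ℤ ≤_) (∣i∣≡0⇒i≡0 (trans (sym (∣H∣ (suc (suc bound)))) (cong ∣_∣ eq))) (num≥1 (a ∘ suc) (1≤a ∘ suc) m))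
          where
          1≰0 : ¬ 1ℤ ≤ 0ℤ
          1≰0 (+≤+ ())

        ℓ₁ : linear K ≡ 0ℤ
        ℓ₁ = linear-vanishes (suc bound) ℕ.≤-refl

        ℓ₂ : linear (suc m ℕ.+ K) ≡ 0ℤ
        ℓ₂ = linear-vanishes (suc (suc bound)) (ℕ.n≤1+n _)

        cancel-H : ∀ {i} → i * H K ≡ 0ℤ → i ≡ 0ℤ
        cancel-H {i} eq with i*j≡0⇒i≡0∨j≡0 i eq
        ... | inj₁ i≡0 = i≡0
        ... | inj₂ H≡0 = ⊥-elim (0<∣H∣ H≡0)

        α≡0 : α ≡ 0ℤ
        α≡0 = cancel-H (proj₁ (cramer α β (num a K) (den a K) (num a (suc m ℕ.+ K)) (den a (suc m ℕ.+ K)) ℓ₁ ℓ₂))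

        β≡0 : β ≡ 0ℤ
        β≡0 = cancel-H (proj₂ (cramer α β (num a K) (den a K) (num a (suc m ℕ.+ K)) (den a (suc m ℕ.+ K)) ℓ₁ ℓ₂))

      -- Together with `Dc≡Qb` this identifies the matrix of a period as multiplication by
      -- `A + c √(D/Q)` on the numbers `x + y √(D/Q)`.
      d≡A : d ≡ A
      d≡A = i-j≡0⇒i≡j d A (*-cancelˡ-≡ (+ Q) (d - A) 0ℤ (trans α≡0 (sym (*-zeroʳ (+ Q)))))

      Dc≡Qb : c * + D ≡ + Q * b
      Dc≡Qb = i-j≡0⇒i≡j (c * + D) (+ Q * b) β≡0

open ContinuedFractions

-- Rational convergents and the cut of the square root.

module Expansions where

  open import Data.Empty using (⊥-elim)
  open import Data.Integer as ℤ using (ℤ; +_; 0ℤ; 1ℤ; +<+; +≤+)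
  import Data.Integer.Properties as ℤ
  open import Data.Integer.Tactic.RingSolver using (solve-∀)
  open import Data.Nat as ℕ using (ℕ; zero; suc; s≤s; z≤n)
  open import Data.Nat.Coprimality using (Coprime)
  import Data.Nat.Properties as ℕ
  open import Data.Product using (_,_; _×_; proj₁; proj₂)
  open import Data.Rational
  open import Data.Rational.Properties
  open import Data.Rational.Solver using (module +-*-Solver)
  open import Data.Rational.Unnormalised as ℚᵘ using (mkℚᵘ)
  import Data.Rational.Unnormalised.Properties as ℚᵘ
  open import Data.Sum using (_⊎_; inj₁; inj₂)
  open import Function using (_∘_)
  open import Relation.Binary.PropositionalEquality

  lowest-terms : ∀ p n d → 1ℤ ℤ.≤ d → Coprime ℤ.∣ n ∣ ℤ.∣ d ∣ → ↥ p ℤ.* d ≡ n ℤ.* ↧ p → ↥ p ≡ n × ↧ p ≡ d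
  lowest-terms p n (+ suc d) _ coprime eq with refl ← ≃⇒≡ {p} {mkℚ n d coprime} (*≡* eq) = refl , refl
  lowest-terms p n (+ zero) (+≤+ ()) _ _

  cross-multiply : ∀ p {u} → toℚᵘ p ℚᵘ.≃ u → ↥ p ℤ.* ℚᵘ.↧ u ≡ ℚᵘ.↥ u ℤ.* ↧ p
  cross-multiply record{} = ℚᵘ.drop-*≡*

  integer-+ : ∀ i p → ↥ (i / 1 + p) ℤ.* ↧ p ≡ (i ℤ.* ↧ p ℤ.+ ↥ p) ℤ.* ↧ (i / 1 + p)
  integer-+ i p@record{} =
    trans (cong (↥ (i / 1 + p) ℤ.*_) (sym (ℤ.*-identityˡ (↧ p))))
      (trans (cross-multiply (i / 1 + p)
          (ℚᵘ.≃-trans (toℚᵘ-homo-+ (i / 1) p) (ℚᵘ.+-congˡ (toℚᵘ p) (toℚᵘ-fromℚᵘ (mkℚᵘ i 0)))))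
        (cong (λ n → (i ℤ.* ↧ p ℤ.+ n) ℤ.* ↧ (i / 1 + p)) (ℤ.*-identityʳ (↥ p))))

  recip-terms : ∀ p → 1ℤ ℤ.≤ ↥ p → ↥ (recip p) ≡ ↧ p × ↧ (recip p) ≡ ↥ p
  recip-terms (mkℚ (+ suc _) _ _) _ = refl , refl
  recip-terms (mkℚ (+ zero) _ _) (+≤+ ())

  -- Continuants are coprime, so they are exactly the terms of the normalised fraction.
  convergent-terms : ∀ a → (∀ i → 1 ℕ.≤ a i) → ∀ k →
    ↥ (convergent a k) ≡ num a (suc k) × ↧ (convergent a k) ≡ den a (suc k)
  convergent-terms a 1≤a zero = lowest-terms (+ a 0 / 1) (num a 1) (den a 1) ℤ.≤-refl (num-den-coprime a 1)
    (trans (cross-multiply (+ a 0 / 1) (toℚᵘ-fromℚᵘ (mkℚᵘ (+ a 0) 0))) (cong (ℤ._* ↧ (+ a 0 / 1)) (identity (+ a 0))))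
    where
    identity : ∀ c → c ≡ c ℤ.* 1ℤ ℤ.+ 0ℤ
    identity = solve-∀
  convergent-terms a 1≤a (suc k) = lowest-terms (convergent a (suc k)) (num a (2 ℕ.+ k)) (den a (2 ℕ.+ k))
    (num≥1 (a ∘ suc) (1≤a ∘ suc) (suc k)) (num-den-coprime a (2 ℕ.+ k))
    (trans (cong (↥ (convergent a (suc k)) ℤ.*_) (sym ↧r))
      (trans (integer-+ (+ a 0) r) (cong (ℤ._* ↧ (convergent a (suc k))) (cong₂ (λ x y → + a 0 ℤ.* x ℤ.+ y) ↧r ↥r))))
    where
    c′ = convergent (a ∘ suc) k
    ih = convergent-terms (a ∘ suc) (1≤a ∘ suc) k
    r = recip c′
    -- Positivity of the numerator keeps `recip` away from its conventional value at `0`.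
    terms = recip-terms c′ (subst (1ℤ ℤ.≤_) (sym (proj₁ ih)) (num≥1 (a ∘ suc) (1≤a ∘ suc) (suc k)))
    ↥r : ↥ r ≡ den (a ∘ suc) (suc k)
    ↥r = trans (proj₁ terms) (proj₂ ih)
    ↧r : ↧ r ≡ num (a ∘ suc) (suc k)
    ↧r = trans (proj₂ terms) (proj₁ ih)

  private
    square-terms : ∀ p → toℚᵘ (p * p) ℚᵘ.≃ toℚᵘ p ℚᵘ.* toℚᵘ p
    square-terms p = toℚᵘ-homo-* p p

    /-terms : ∀ D Q .{{_ : ℕ.NonZero Q}} → toℚᵘ (+ D / Q) ℚᵘ.≃ + D ℚᵘ./ Q
    /-terms D (suc Q) = toℚᵘ-fromℚᵘ (mkℚᵘ (+ D) Q)

  square-<-/ : ∀ p D Q .{{_ : ℕ.NonZero Q}} → p * p < + D / Q → + 0 ℤ.< + D ℤ.* (↧ p ℤ.* ↧ p) ℤ.- + Q ℤ.* (↥ p ℤ.* ↥ p)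
  square-<-/ p@record{} D (suc Q) p²<D/Q = <⇒0<j-i (subst (ℤ._< + D ℤ.* (↧ p ℤ.* ↧ p)) (ℤ.*-comm (↥ p ℤ.* ↥ p) (+ suc Q))
    (ℚᵘ.drop-*<* (ℚᵘ.<-respˡ-≃ (square-terms p) (ℚᵘ.<-respʳ-≃ (/-terms D (suc Q)) (toℚᵘ-mono-< p²<D/Q)))))

  /-<-square : ∀ p D Q .{{_ : ℕ.NonZero Q}} → + D / Q < p * p → + 0 ℤ.< + Q ℤ.* (↥ p ℤ.* ↥ p) ℤ.- + D ℤ.* (↧ p ℤ.* ↧ p)
  /-<-square p@record{} D (suc Q) D/Q<p² = <⇒0<j-i (subst (+ D ℤ.* (↧ p ℤ.* ↧ p) ℤ.<_) (ℤ.*-comm (↥ p ℤ.* ↥ p) (+ suc Q))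
    (ℚᵘ.drop-*<* (ℚᵘ.<-respʳ-≃ (square-terms p) (ℚᵘ.<-respˡ-≃ (/-terms D (suc Q)) (toℚᵘ-mono-< D/Q<p²)))))

  reflect : ∀ q r → q - (q - r) ≡ r
  reflect = solve 2 (λ q r → q :- (q :- r) := r) refl
    where open +-*-Solver

  square-mono-≤ : ∀ {p q} → 0ℚ ≤ p → p ≤ q → p * p ≤ q * q
  square-mono-≤ {p} {q} 0≤p p≤q = ≤-trans (*-monoˡ-≤-nonNeg p {{nonNegative 0≤p}} p≤q)
    (*-monoʳ-≤-nonNeg q {{nonNegative (≤-trans 0≤p p≤q)}} p≤q)

  lower-sqrt : ∀ {α p q} → 0ℚ ≤ p → p ≤ q → lower (sqrt α) q → p * p < α
  lower-sqrt 0≤p p≤q (inj₁ q<0)  = ⊥-elim (<-irrefl refl (≤-<-trans (≤-trans 0≤p p≤q) q<0))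
  lower-sqrt 0≤p p≤q (inj₂ q²<α) = ≤-<-trans (square-mono-≤ 0≤p p≤q) q²<α

  upper-sqrt : ∀ {α p q} → 0ℚ ≤ q → q ≤ p → upper (sqrt α) q → α < p * p
  upper-sqrt 0≤q q≤p (_ , α<q²) = <-≤-trans α<q² (square-mono-≤ 0≤q q≤p)

  module _ (a : ℕ → ℕ) (1≤a : ∀ i → 1 ℕ.≤ a i) where

    convergent≥0 : ∀ k → 0ℚ ≤ convergent a k
    convergent≥0 k = *≤* (subst₂ ℤ._≤_ (sym (ℤ.*-zeroˡ (↧ convergent a k))) (sym (ℤ.*-identityʳ (↥ convergent a k)))
      (ℤ.≤-trans (+≤+ z≤n) (subst (1ℤ ℤ.≤_) (sym (proj₁ (convergent-terms a 1≤a k))) (num≥1 a 1≤a (suc k)))))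

    private
      c = convergent a

      convergent-< : ∀ i j → 0ℤ ℤ.< num a (suc j) ℤ.* den a (suc i) ℤ.- num a (suc i) ℤ.* den a (suc j) → c i < c j
      convergent-< i j 0<det = *<* (subst₂ ℤ._<_
        (sym (cong₂ ℤ._*_ (proj₁ (convergent-terms a 1≤a i)) (proj₂ (convergent-terms a 1≤a j))))
        (sym (cong₂ ℤ._*_ (proj₁ (convergent-terms a 1≤a j)) (proj₂ (convergent-terms a 1≤a i))))
        (0<j-i⇒< 0<det))

      det₂ : ∀ k → num a (3 ℕ.+ k) ℤ.* den a (suc k) ℤ.- num a (suc k) ℤ.* den a (3 ℕ.+ k) ≡ + a (2 ℕ.+ k) ℤ.* sign k
      det₂ k = trans (cong₂ (λ n d → n ℤ.* y ℤ.- x ℤ.* d) (num-rec a (suc k)) (den-rec a (suc k)))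
        (trans (identity (+ a (2 ℕ.+ k)) x y (num a (2 ℕ.+ k)) (den a (2 ℕ.+ k)))
          (cong (+ a (2 ℕ.+ k) ℤ.*_) (trans (cong ℤ.-_ (det-convergents a (suc k))) (ℤ.neg-involutive (sign k)))))
        where
        x = num a (suc k)
        y = den a (suc k)
        identity : ∀ c x y x′ y′ → (x ℤ.+ c ℤ.* x′) ℤ.* y ℤ.- x ℤ.* (y ℤ.+ c ℤ.* y′) ≡ c ℤ.* ℤ.- (x ℤ.* y′ ℤ.- x′ ℤ.* y)
        identity = solve-∀

      det₂-swap : ∀ x y x′ y′ → x ℤ.* y ℤ.- x′ ℤ.* y′ ≡ ℤ.- (x′ ℤ.* y′ ℤ.- x ℤ.* y)
      det₂-swap = solve-∀

      0<a : ∀ k → 0ℤ ℤ.< + a k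
      0<a k = +<+ (1≤a k)

      even-increasing : ∀ k → sign k ≡ 1ℤ → c k < c (2 ℕ.+ k)
      even-increasing k even = convergent-< k (2 ℕ.+ k) (subst (0ℤ ℤ.<_)
        (sym (trans (det₂ k) (trans (cong (+ a (2 ℕ.+ k) ℤ.*_) even) (ℤ.*-identityʳ (+ a (2 ℕ.+ k)))))) (0<a (2 ℕ.+ k)))

      odd-decreasing : ∀ k → sign k ≡ ℤ.- 1ℤ → c (2 ℕ.+ k) < c k
      odd-decreasing k odd = convergent-< (2 ℕ.+ k) k (subst (0ℤ ℤ.<_)
        (sym (trans (det₂-swap (num a (suc k)) (den a (3 ℕ.+ k)) (num a (3 ℕ.+ k)) (den a (suc k)))
          (trans (cong ℤ.-_ (trans (det₂ k) (cong (+ a (2 ℕ.+ k) ℤ.*_) odd))) (identity (+ a (2 ℕ.+ k)))))) (0<a (2 ℕ.+ k)))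
        where
        identity : ∀ x → ℤ.- (x ℤ.* ℤ.- 1ℤ) ≡ x
        identity = solve-∀

      sign-even-step : ∀ j k → sign (j ℕ.* 2 ℕ.+ k) ≡ sign k
      sign-even-step zero    k = refl
      sign-even-step (suc j) k = trans (ℤ.neg-involutive (sign (j ℕ.* 2 ℕ.+ k))) (sign-even-step j k)

      even-≤ : ∀ j k → sign k ≡ 1ℤ → c k ≤ c (j ℕ.* 2 ℕ.+ k)
      even-≤ zero    k even = ≤-refl
      even-≤ (suc j) k even = ≤-trans (even-≤ j k even)
        (<⇒≤ (even-increasing (j ℕ.* 2 ℕ.+ k) (trans (sign-even-step j k) even)))

      odd-≥ : ∀ j k → sign k ≡ ℤ.- 1ℤ → c (j ℕ.* 2 ℕ.+ k) ≤ c k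
      odd-≥ zero    k odd = ≤-refl
      odd-≥ (suc j) k odd = ≤-trans (<⇒≤ (odd-decreasing (j ℕ.* 2 ℕ.+ k) (trans (sign-even-step j k) odd)))
        (odd-≥ j k odd)

      far : ∀ N k → N ℕ.≤ N ℕ.* 2 ℕ.+ k
      far N k = ℕ.≤-trans (ℕ.m≤m*n N 2) (ℕ.m≤m+n (N ℕ.* 2) k)

      positive-gap : ∀ {p q} → p < q → 0ℚ < q - p
      positive-gap {p} {q} p<q = subst (_< q - p) (+-inverseʳ p) (+-monoˡ-< (- p) p<q)

    -- The tolerance `ε` is the gap from `c k` to the next even convergent. Far out, `c K - ε` lies
    -- in the lower cut, and it is at least `c k` because the even convergents increase.
    even-convergent< : ∀ {α} → sqrt α HasExpansion a → ∀ k → sign k ≡ 1ℤ → c k * c k < α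
    even-convergent< expansion k even =
      lower-sqrt (convergent≥0 k) (subst (_≤ c K - ε) (reflect (c (2 ℕ.+ k)) (c k)) (+-monoˡ-≤ (- ε) (even-≤ N (2 ℕ.+ k) even″)))
        (proj₁ (proj₂ limit K (far N (2 ℕ.+ k))))
      where
      even″ : sign (2 ℕ.+ k) ≡ 1ℤ
      even″ = trans (ℤ.neg-involutive (sign k)) even
      ε = c (2 ℕ.+ k) - c k
      limit = expansion ε (positive-gap (even-increasing k even))
      N = proj₁ limit
      -- At least `N`, and of the same parity as `k`.
      K = N ℕ.* 2 ℕ.+ (2 ℕ.+ k)

    odd-convergent> : ∀ {α} → sqrt α HasExpansion a → ∀ k → sign k ≡ ℤ.- 1ℤ → α < c k * c k
    odd-convergent> expansion k odd =
      upper-sqrt (≤-trans (convergent≥0 K) (subst (_≤ c K + ε) (+-identityʳ (c K)) (+-monoʳ-≤ (c K) (<⇒≤ 0<ε))))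
        (subst (c K + ε ≤_) (reflect′ (c (2 ℕ.+ k)) (c k)) (+-monoˡ-≤ ε (odd-≥ N (2 ℕ.+ k) odd″)))
        (proj₂ (proj₂ limit K (far N (2 ℕ.+ k))))
      where
      odd″ : sign (2 ℕ.+ k) ≡ ℤ.- 1ℤ
      odd″ = trans (ℤ.neg-involutive (sign k)) odd
      ε = c k - c (2 ℕ.+ k)
      0<ε = positive-gap (odd-decreasing k odd)
      limit = expansion ε 0<ε
      N = proj₁ limit
      K = N ℕ.* 2 ℕ.+ (2 ℕ.+ k)
      reflect′ : ∀ q r → q + (r - q) ≡ r
      reflect′ = solve 2 (λ q r → q :+ (r :- q) := r) refl
        where open +-*-Solver

    -- At index 0, that is at `(1 , 0)`, the form is `Q`. Index `suc k` belongs to the `k`-th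
    -- convergent, which lies below the root for even `k` and above it for odd `k`.
    expansion⇒alternating : ∀ D Q .{{_ : ℕ.NonZero Q}} → sqrt (+ D / Q) HasExpansion a → Alternating (+ D) (+ Q) a
    expansion⇒alternating D (suc Q) expansion zero = subst (0ℤ ℤ.<_) (identity (+ D) (+ suc Q)) (+<+ (s≤s z≤n))
      where
      identity : ∀ D Q → Q ≡ 1ℤ ℤ.* (Q ℤ.* (1ℤ ℤ.* 1ℤ) ℤ.- D ℤ.* (0ℤ ℤ.* 0ℤ))
      identity = solve-∀
    expansion⇒alternating D Q expansion (suc k) = by-parity (sign-cases k)
      where
      x = num a (suc k)
      y = den a (suc k)
      ↥c = proj₁ (convergent-terms a 1≤a k)
      ↧c = proj₂ (convergent-terms a 1≤a k)
      below : ∀ D Q x y → D ℤ.* (y ℤ.* y) ℤ.- Q ℤ.* (x ℤ.* x) ≡ ℤ.- 1ℤ ℤ.* (Q ℤ.* (x ℤ.* x) ℤ.- D ℤ.* (y ℤ.* y))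
      below = solve-∀
      by-parity : sign k ≡ 1ℤ ⊎ sign k ≡ ℤ.- 1ℤ → 0ℤ ℤ.< ℤ.- sign k ℤ.* form (+ D) (+ Q) x y
      by-parity (inj₁ even) = subst (0ℤ ℤ.<_)
        (trans (cong₂ (λ x y → + D ℤ.* (y ℤ.* y) ℤ.- + Q ℤ.* (x ℤ.* x)) ↥c ↧c)
          (trans (below (+ D) (+ Q) x y) (cong (λ s → ℤ.- s ℤ.* form (+ D) (+ Q) x y) (sym even))))
        (square-<-/ (c k) D Q (even-convergent< expansion k even))
      by-parity (inj₂ odd) = subst (0ℤ ℤ.<_)
        (trans (cong₂ (form (+ D) (+ Q)) ↥c ↧c)
          (trans (sym (ℤ.*-identityˡ (form (+ D) (+ Q) x y))) (cong (λ s → ℤ.- s ℤ.* form (+ D) (+ Q) x y) (sym odd))))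
        (/-<-square (c k) D Q (odd-convergent> expansion k odd))

open Expansions

-- The periodic sequence of quotients.

module PeriodicQuotients where

  open import Data.Fin using (fromℕ)
  open import Data.Fin.Properties using (toℕ-injective; toℕ-fromℕ; toℕ-fromℕ<)
  open import Data.Nat
  open import Data.Nat.DivMod
  open import Data.Nat.Properties
  open import Data.Vec using (Vec; []; _∷_; _∷ʳ_; lookup)
  open import Data.Vec.Relation.Unary.All using (All; []; _∷_)
  import Data.Vec.Relation.Unary.All.Properties as All
  open import Relation.Binary.PropositionalEquality

  lookup-last : ∀ {n} (xs : Vec ℕ n) x → lookup (xs ∷ʳ x) (fromℕ n) ≡ x
  lookup-last []       x = refl
  lookup-last (_ ∷ xs) x = lookup-last xs x

  All-∷ʳ : ∀ {n} {xs : Vec ℕ n} {x} {P : ℕ → Set} → All P xs → P x → All P (xs ∷ʳ x)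
  All-∷ʳ []         px = px ∷ []
  All-∷ʳ (py ∷ pxs) px = py ∷ All-∷ʳ pxs px

  module _ {m} (b₀ : ℕ) (bs : Vec ℕ m) where

    periodic-positive : 1 ≤ b₀ → All (1 ≤_) bs → ∀ i → 1 ≤ periodic b₀ bs i
    periodic-positive 1≤b₀ 1≤bs zero    = 1≤b₀
    periodic-positive 1≤b₀ 1≤bs (suc i) = All.lookup⁺ (All-∷ʳ 1≤bs (≤-trans 1≤b₀ (m≤m+n b₀ (b₀ + 0)))) (i mod suc m)

    mod-cong : ∀ {i j} → i % suc m ≡ j % suc m → i mod suc m ≡ j mod suc m
    mod-cong {i} {j} eq = toℕ-injective (trans (toℕ-fromℕ< (m%n<n i (suc m))) (trans eq (sym (toℕ-fromℕ< (m%n<n j (suc m))))))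

    periodic-end : periodic b₀ bs (suc m) ≡ 2 * b₀
    periodic-end = trans (cong (lookup (bs ∷ʳ 2 * b₀)) (toℕ-injective {i = m mod suc m} {fromℕ m}
        (trans (toℕ-fromℕ< (m%n<n m (suc m))) (trans (m<n⇒m%n≡m (n<1+n m)) (sym (toℕ-fromℕ m))))))
      (lookup-last bs (2 * b₀))

    -- Only positive indices repeat: the initial `b₀` stands outside the block, which has `2 b₀` in
    -- the corresponding place.
    periodic-period : ∀ i → periodic b₀ bs (suc m + suc i) ≡ periodic b₀ bs (suc i)
    periodic-period i = cong (lookup (bs ∷ʳ 2 * b₀)) (mod-cong {m + suc i} {i} (trans (cong (_% suc m)
      (trans (+-suc m i) (+-comm (suc m) i))) ([m+n]%n≡m%n i (suc m))))

-- Norms and signs of units.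

module Units where

  open import Data.Empty using (⊥-elim)
  open import Data.Integer hiding (suc; sign; _/_)
  open import Data.Integer.Divisibility.Signed using (_∣_; ∣ᵤ⇒∣; ∣⇒∣ᵤ; ∣m∣n⇒∣m+n; ∣m∣n⇒∣m-n; ∣m⇒∣m*n; ∣n⇒∣m*n; ∣-refl)
  open import Data.Integer.GCD using (gcd)
  open import Data.Integer.Properties
  open import Data.Integer.Tactic.RingSolver using (solve-∀)
  open import Data.Nat as ℕ using (ℕ; zero; suc; s≤s; z≤n)
  open import Data.Nat.Coprimality as Coprimality using (Coprime)
  import Data.Nat.Divisibility as ℕ
  import Data.Nat.GCD as ℕ
  import Data.Nat.Properties as ℕ
  open import Data.Product using (_,_; _×_; proj₁; proj₂; ∃-syntax)
  open import Data.Rational as ℚ using (0ℚ; 1ℚ; ↥_; ↧_; _/_)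
  import Data.Rational.Properties as ℚ
  open import Data.Rational.Unnormalised as ℚᵘ using (mkℚᵘ)
  import Data.Rational.Unnormalised.Properties as ℚᵘ
  open import Data.Sum using (inj₁; inj₂)
  open import Relation.Binary.Definitions using (tri<; tri≈; tri>)
  open import Relation.Binary.PropositionalEquality
  open import Relation.Nullary using (¬_)

  norm : ∀ {d} → ℤ[√ d ] → ℤ
  norm {d} (r +√ s) = r * r - + d * (s * s)

  norm-· : ∀ {d} (u v : ℤ[√ d ]) → norm (u · v) ≡ norm u * norm v
  norm-· {d} (r +√ s) (r′ +√ s′) = identity (+ d) r s r′ s′
    where
    identity : ∀ d r s r′ s′ →
      (r * r′ + d * (s * s′)) * (r * r′ + d * (s * s′)) - d * ((r * s′ + s * r′) * (r * s′ + s * r′)) ≡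
      (r * r - d * (s * s)) * (r′ * r′ - d * (s′ * s′))
    identity = solve-∀

  unit⇒∣norm∣≡1 : ∀ {d} (u : ℤ[√ d ]) → IsUnit u → ∣ norm u ∣ ≡ 1
  unit⇒∣norm∣≡1 {d} u (v , _ , uv≡1) = ℕ.m*n≡1⇒m≡1 ∣ norm u ∣ ∣ norm v ∣
    (trans (sym (abs-* (norm u) (norm v))) (cong ∣_∣ (trans (sym (norm-· u v)) (trans (cong norm uv≡1) (norm-one (+ d))))))
    where
    norm-one : ∀ d → 1ℤ * 1ℤ - d * (0ℤ * 0ℤ) ≡ 1ℤ
    norm-one = solve-∀

  ∣i∣≡1⇒i*i≡1 : ∀ i → ∣ i ∣ ≡ 1 → i * i ≡ 1ℤ
  ∣i∣≡1⇒i*i≡1 (+ 1)       refl = refl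
  ∣i∣≡1⇒i*i≡1 (-[1+ 0 ])  refl = refl

  -- The inverse is the conjugate times the norm, the norm being its own inverse.
  ∣norm∣≡1⇒unit : ∀ {d} (u : ℤ[√ d ]) → ∣ norm u ∣ ≡ 1 → IsUnit u
  ∣norm∣≡1⇒unit {d} u@(r +√ s) ∣n∣≡1 = v , cong₂ _+√_ (trans (identity₁ (+ d) r s n) n²≡1) (identity₂ r s n)
                                        , cong₂ _+√_ (trans (identity₃ (+ d) r s n) n²≡1) (identity₄ r s n)
    where
    n = norm u
    n²≡1 = ∣i∣≡1⇒i*i≡1 n ∣n∣≡1
    v : ℤ[√ d ]
    v = n * r +√ - (n * s)
    identity₁ : ∀ d r s n → n * r * r + d * (- (n * s) * s) ≡ n * (r * r - d * (s * s))
    identity₁ = solve-∀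
    identity₂ : ∀ r s n → n * r * s + - (n * s) * r ≡ 0ℤ
    identity₂ = solve-∀
    identity₃ : ∀ d r s n → r * (n * r) + d * (s * - (n * s)) ≡ n * (r * r - d * (s * s))
    identity₃ = solve-∀
    identity₄ : ∀ r s n → r * - (n * s) + s * (n * r) ≡ 0ℤ
    identity₄ = solve-∀

  ∣i∣≡1⇒i≯1 : ∀ {i} → ∣ i ∣ ≡ 1 → ¬ 1ℤ < i
  ∣i∣≡1⇒i≯1 {+ 1} refl (+<+ (s≤s ()))

  square-mono-< : ∀ {i j} → 0ℤ ≤ i → i < j → 0ℤ < j * j - i * i
  square-mono-< {i} {j} 0≤i i<j = subst (0ℤ <_) (identity i j)
    (*-pos (<⇒0<j-i i<j) (+-mono-<-≤ (≤-<-trans 0≤i i<j) 0≤i))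
    where
    identity : ∀ i j → (j - i) * (j + i) ≡ j * j - i * i
    identity = solve-∀

  1<affine : ∀ r s p → 1ℚ ℚ.< r / 1 ℚ.+ s / 1 ℚ.* p → 0ℤ < (r - 1ℤ) * ↧ p + s * ↥ p
  1<affine r s p@record{} 1<u = subst (0ℤ <_) (identity r s (↥ p) (↧ p))
    (<⇒0<j-i (ℚᵘ.drop-*<* (ℚᵘ.<-respʳ-≃ terms (ℚ.toℚᵘ-mono-< 1<u))))
    where
    terms : ℚ.toℚᵘ (r / 1 ℚ.+ s / 1 ℚ.* p) ℚᵘ.≃ mkℚᵘ r 0 ℚᵘ.+ mkℚᵘ s 0 ℚᵘ.* ℚ.toℚᵘ p
    terms = ℚᵘ.≃-trans (ℚ.toℚᵘ-homo-+ (r / 1) (s / 1 ℚ.* p))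
      (ℚᵘ.+-cong (ℚ.toℚᵘ-fromℚᵘ (mkℚᵘ r 0))
        (ℚᵘ.≃-trans (ℚ.toℚᵘ-homo-* (s / 1) p) (ℚᵘ.*-congʳ {ℚ.toℚᵘ p} (ℚ.toℚᵘ-fromℚᵘ (mkℚᵘ s 0)))))
    identity : ∀ r s n d → (r * (1ℤ * d) + s * n * 1ℤ) * 1ℤ - 1ℤ * (1ℤ * (1ℤ * d)) ≡ (r - 1ℤ) * d + s * n
    identity = solve-∀

  0<p⇒0<↥p : ∀ p → 0ℚ ℚ.< p → 0ℤ < ↥ p
  0<p⇒0<↥p p@record{} (ℚ.*<* 0<↥p) = subst (0ℤ <_) (*-identityʳ (↥ p)) 0<↥p

  -- `D` is the radicand and `n / d` a rational above its root. From
  -- `r - 1 > - s n / d ≥ - s √D ≥ 0` follows `(r - 1)² > D s²`, and the norm minus `1` is this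
  -- difference plus `2 (r - 1)`.
  im≤0⇒1<norm : ∀ D r s n d → 0ℤ ≤ d → s ≤ 0ℤ → 0ℤ < n → 0ℤ < (r - 1ℤ) * d + s * n →
    0ℤ < 1ℤ * (n * n) - D * (d * d) → 1ℤ < r * r - D * (s * s)
  im≤0⇒1<norm D r s n d 0≤d s≤0 0<n 1<u √D<n/d =
    0<j-i⇒< (subst (0ℤ <_) (identity D r s) (+-mono-<-≤ 0<difference (+-mono-≤ (<⇒≤ 0<r-1) (<⇒≤ 0<r-1))))
    where
    0≤-sn : 0ℤ ≤ - s * n
    0≤-sn = *-nonNeg (neg-mono-≤ s≤0) (<⇒≤ 0<n)
    turn : ∀ r s n d → (r - 1ℤ) * d + s * n ≡ (r - 1ℤ) * d - - s * n
    turn = solve-∀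
    -sn<[r-1]d : - s * n < (r - 1ℤ) * d
    -sn<[r-1]d = 0<j-i⇒< (subst (0ℤ <_) (turn r s n d) 1<u)
    0<r-1 : 0ℤ < r - 1ℤ
    0<r-1 = pos-cancelʳ 0≤d (≤-<-trans 0≤-sn -sn<[r-1]d)
    combine : ∀ D r s n d →
      (r - 1ℤ) * d * ((r - 1ℤ) * d) - - s * n * (- s * n) + s * s * (1ℤ * (n * n) - D * (d * d)) ≡
      d * d * ((r - 1ℤ) * (r - 1ℤ) - D * (s * s))
    combine = solve-∀
    0<difference : 0ℤ < (r - 1ℤ) * (r - 1ℤ) - D * (s * s)
    0<difference = pos-cancelˡ (i*i-nonNeg d) (subst (0ℤ <_) (combine D r s n d)
      (+-mono-<-≤ (square-mono-< 0≤-sn -sn<[r-1]d) (*-nonNeg (i*i-nonNeg s) (<⇒≤ √D<n/d))))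
    identity : ∀ D r s → (r - 1ℤ) * (r - 1ℤ) - D * (s * s) + ((r - 1ℤ) + (r - 1ℤ)) ≡ r * r - D * (s * s) - 1ℤ
    identity = solve-∀

  -- Now `n / d` has square below `D`. From `s n / d > 1 - r ≥ 1` follows `D s² > (1 - r)²`, and
  -- minus the norm, less `1`, is this difference plus `- 2 r`.
  re≤0⇒1<-norm : ∀ D r s n d → 0ℤ ≤ d → r ≤ 0ℤ → 0ℤ < s → 0ℤ < (r - 1ℤ) * d + s * n →
    0ℤ < D * (d * d) - 1ℤ * (n * n) → 1ℤ < - (r * r - D * (s * s))
  re≤0⇒1<-norm D r s n d 0≤d r≤0 0<s 1<u n/d<√D =
    0<j-i⇒< (subst (0ℤ <_) (identity D r s) (+-mono-<-≤ 0<difference (+-mono-≤ (neg-mono-≤ r≤0) (neg-mono-≤ r≤0))))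
    where
    0≤[1-r]d : 0ℤ ≤ (1ℤ - r) * d
    0≤[1-r]d = *-nonNeg (i≤j⇒0≤j-i (≤-trans r≤0 (+≤+ z≤n))) 0≤d
    turn : ∀ r s n d → (r - 1ℤ) * d + s * n ≡ s * n - (1ℤ - r) * d
    turn = solve-∀
    [1-r]d<sn : (1ℤ - r) * d < s * n
    [1-r]d<sn = 0<j-i⇒< (subst (0ℤ <_) (turn r s n d) 1<u)
    combine : ∀ D r s n d →
      s * n * (s * n) - (1ℤ - r) * d * ((1ℤ - r) * d) + s * s * (D * (d * d) - 1ℤ * (n * n)) ≡
      d * d * (D * (s * s) - (1ℤ - r) * (1ℤ - r))
    combine = solve-∀
    0<difference : 0ℤ < D * (s * s) - (1ℤ - r) * (1ℤ - r)
    0<difference = pos-cancelˡ (i*i-nonNeg d) (subst (0ℤ <_) (combine D r s n d)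
      (+-mono-<-≤ (square-mono-< 0≤[1-r]d [1-r]d<sn) (*-nonNeg (i*i-nonNeg s) (<⇒≤ n/d<√D))))
    identity : ∀ D r s → D * (s * s) - (1ℤ - r) * (1ℤ - r) + (- r + - r) ≡ - (r * r - D * (s * s)) - 1ℤ
    identity = solve-∀

  -- The lower cut of a root also contains the negative rationals, which are excluded here: they
  -- make `r + s p` negative.
  negative-absurd : ∀ r s p → r ≤ 0ℤ → 0ℤ < s → 0ℤ < (r - 1ℤ) * ↧ p + s * ↥ p → ¬ p ℚ.< 0ℚ
  negative-absurd r s p@record{} r≤0 0<s 1<u (ℚ.*<* ↥p<0) =
    <-asym (pos-cancelˡ {s} (<⇒≤ 0<s) (subst (0ℤ <_) (identity r s (↥ p) (↧ p))
        (+-mono-<-≤ 1<u (*-nonNeg {1ℤ - r} {↧ p} (i≤j⇒0≤j-i (≤-trans r≤0 (+≤+ z≤n))) (+≤+ z≤n)))))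
      (subst (_< 0ℤ) (*-identityʳ (↥ p)) ↥p<0)
    where
    identity : ∀ r s n d → (r - 1ℤ) * d + s * n + (1ℤ - r) * d ≡ s * n
    identity = solve-∀

  0≤↧ : ∀ p → 0ℤ ≤ ↧ p
  0≤↧ record{} = +≤+ z≤n

  -- A coordinate that is not positive would force the norm beyond `1` in absolute value. The upper
  -- endpoint of the interval in `affine` settles the irrational coefficient, the lower endpoint the
  -- rational part.
  unit>1⇒im>0 : ∀ {d} (u : ℤ[√ d ]) → ∣ norm u ∣ ≡ 1 → lower (toReal u) 1ℚ → 0ℤ < ℤ[√_].im u
  unit>1⇒im>0 {d} (r +√ s) ∣n∣≡1 (_ , p , _ , (0<p , d<p²) , _ , 1<u) with <-cmp 0ℤ s
  ... | tri< 0<s _ _ = 0<s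
  ... | tri≈ _ 0≡s _ = ⊥-elim (∣i∣≡1⇒i≯1 ∣n∣≡1 (im≤0⇒1<norm (+ d) r s (↥ p) (↧ p)
          (0≤↧ p) (≤-reflexive (sym 0≡s)) (0<p⇒0<↥p p 0<p) (1<affine r s p 1<u) (/-<-square p d 1 d<p²)))
  ... | tri> _ _ s<0 = ⊥-elim (∣i∣≡1⇒i≯1 ∣n∣≡1 (im≤0⇒1<norm (+ d) r s (↥ p) (↧ p)
          (0≤↧ p) (<⇒≤ s<0) (0<p⇒0<↥p p 0<p) (1<affine r s p 1<u) (/-<-square p d 1 d<p²)))

  unit>1⇒re>0 : ∀ {d} (u : ℤ[√ d ]) → ∣ norm u ∣ ≡ 1 → lower (toReal u) 1ℚ → 0ℤ < ℤ[√_].re u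
  unit>1⇒re>0 {d} u@(r +√ s) ∣n∣≡1 u>1@(p , _ , p<√d , _ , 1<u , _) = ≰⇒> λ r≤0 → absurd r≤0 p<√d
    where
    0<s = unit>1⇒im>0 u ∣n∣≡1 u>1
    absurd : r ≤ 0ℤ → ¬ lower (sqrt (+ d / 1)) p
    absurd r≤0 (inj₁ p<0)  = negative-absurd r s p r≤0 0<s (1<affine r s p 1<u) p<0
    absurd r≤0 (inj₂ p²<d) = ∣i∣≡1⇒i≯1 (trans (∣-i∣≡∣i∣ (norm u)) ∣n∣≡1)
      (re≤0⇒1<-norm (+ d) r s (↥ p) (↧ p) (0≤↧ p) r≤0 0<s (1<affine r s p 1<u) (square-<-/ p d 1 p²<d))

  -- The convergent belonging to a unit.

  ∣i∣≤n⇒small : ∀ {i n} → ∣ i ∣ ℕ.≤ n → Small (+ n) i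
  ∣i∣≤n⇒small {+ i}      i≤n = ≤-trans (neg-≤-pos {_} {0}) (+≤+ z≤n) , +≤+ i≤n
  ∣i∣≤n⇒small { -[1+ i ]} i<n = neg-mono-≤ (+≤+ i<n) , -≤+

  module _ (D Q q d : ℕ) (dQ≡Dq² : + d * + Q ≡ + D * (+ q * + q)) .{{_ : ℕ.NonZero q}} where

    -- With t = gcd ρ q, the form is ± Q / t² at (ρ / t , σ q / t).
    unit-small : ∀ x y g ρ σ → 1 ℕ.≤ g → ∣ + ρ * + ρ - + d * (+ σ * + σ) ∣ ≡ 1 →
      + ρ ≡ + x * + g → + σ * + q ≡ + y * + g → Small (+ Q) (form (+ D) (+ Q) (+ x) (+ y))
    unit-small x y g ρ σ 1≤g ∣n∣≡1 ρ≡ σq≡ = ∣i∣≤n⇒small (ℕ.≤-trans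
      (ℕ.m≤n*m ∣ F ∣ ∣ + g * + g ∣ {{ℕ.>-nonZero (subst (1 ℕ.≤_) (sym (abs-* (+ g) (+ g))) (ℕ.*-mono-≤ 1≤g 1≤g))}})
      (ℕ.≤-reflexive (trans (sym (abs-* (+ g * + g) F)) (trans (cong ∣_∣ g²F≡)
        (trans (abs-* (+ Q) (+ ρ * + ρ - + d * (+ σ * + σ))) (trans (cong (Q ℕ.*_) ∣n∣≡1) (ℕ.*-identityʳ Q)))))))
      where
      F = form (+ D) (+ Q) (+ x) (+ y)
      identity₁ : ∀ D Q x y g → g * g * (Q * (x * x) - D * (y * y)) ≡ Q * (x * g * (x * g)) - D * (y * g * (y * g))
      identity₁ = solve-∀
      identity₂ : ∀ D Q ρ σ q → Q * (ρ * ρ) - D * (σ * q * (σ * q)) ≡ Q * (ρ * ρ) - D * (q * q) * (σ * σ)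
      identity₂ = solve-∀
      identity₃ : ∀ d Q ρ σ → Q * (ρ * ρ) - d * Q * (σ * σ) ≡ Q * (ρ * ρ - d * (σ * σ))
      identity₃ = solve-∀
      g²F≡ : + g * + g * F ≡ + Q * (+ ρ * + ρ - + d * (+ σ * + σ))
      g²F≡ = trans (identity₁ (+ D) (+ Q) (+ x) (+ y) (+ g))
        (trans (cong₂ (λ u v → + Q * (u * u) - + D * (v * v)) (sym ρ≡) (sym σq≡))
          (trans (identity₂ (+ D) (+ Q) (+ ρ) (+ σ) (+ q))
            (trans (cong (λ z → + Q * (+ ρ * + ρ) - z * (+ σ * + σ)) (sym dQ≡Dq²))
              (identity₃ (+ d) (+ Q) (+ ρ) (+ σ)))))

    -- A common divisor `c` of `x` and `σ y` divides `ρ`, which is prime to `σ` by the norm, so `c`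
    -- divides `y`. Then `c` times the gcd of `ρ` and `q` divides both of them, hence divides that
    -- gcd.
    reduced-coprime : ∀ ρ σ → ∣ + ρ * + ρ - + d * (+ σ * + σ) ∣ ≡ 1 →
      ∀ x y → ρ ≡ x ℕ.* ℕ.gcd ρ q → q ≡ y ℕ.* ℕ.gcd ρ q → Coprime x (σ ℕ.* y)
    reduced-coprime ρ σ ∣n∣≡1 x y ρ≡ q≡ {c} (c∣x , c∣σy) = ℕ.∣1⇒≡1 (ℕ.*-cancelʳ-∣ g {{g≢0}}
      (subst (c ℕ.* g ℕ.∣_) (sym (ℕ.*-identityˡ g))
        (ℕ.gcd-greatest (subst (c ℕ.* g ℕ.∣_) (sym ρ≡) (ℕ.*-monoˡ-∣ g c∣x)) (subst (c ℕ.* g ℕ.∣_) (sym q≡) (ℕ.*-monoˡ-∣ g c∣y)))))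
      where
      g = ℕ.gcd ρ q
      g≢0 : ℕ.NonZero g
      g≢0 = ℕ.≢-nonZero (ℕ.gcd[m,n]≢0 ρ q (inj₂ (ℕ.≢-nonZero⁻¹ q)))
      rearrange : ∀ d ρ σ → ρ * ρ - d * σ * σ ≡ ρ * ρ - d * (σ * σ)
      rearrange = solve-∀
      ρ⊥σ : Coprime ρ σ
      ρ⊥σ = ∣det∣≡1⇒coprime (+ ρ) (+ σ) (+ d * + σ) (+ ρ) (trans (cong ∣_∣ (rearrange (+ d) (+ ρ) (+ σ))) ∣n∣≡1)
      c∣ρ : c ℕ.∣ ρ
      c∣ρ = subst (c ℕ.∣_) (sym ρ≡) (ℕ.∣m⇒∣m*n g c∣x)
      c∣y : c ℕ.∣ y
      c∣y = Coprimality.coprime-divisor (λ (e∣c , e∣σ) → ρ⊥σ (ℕ.∣-trans e∣c c∣ρ , e∣σ)) c∣σy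

    unit-convergent : ∀ (a : ℕ → ℕ) → (∀ i → 1 ℕ.≤ a i) → Alternating (+ D) (+ Q) a →
      0ℤ < + D → + Q ≤ + D → ∀ r s → 0ℤ < r → 0ℤ < s → ∣ r * r - + d * (s * s) ∣ ≡ 1 →
      ∃[ j ] r ≡ gcd r (+ q) * num a (suc j) × s * + q ≡ gcd r (+ q) * den a (suc j)
    unit-convergent a 1≤a alternating 0<D Q≤D (+ ρ) (+ σ) 0<ρ 0<σ ∣n∣≡1 =
      proj₁ found ,
      trans ρ≡ (trans (*-comm (+ x) (+ g)) (cong (+ g *_) (proj₁ (proj₂ found)))) ,
      trans σq≡ (trans (*-comm (+ (σ ℕ.* y)) (+ g)) (cong (+ g *_) (proj₂ (proj₂ found))))
      where
      g = ℕ.gcd ρ q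
      x = ℕ.quotient (ℕ.gcd[m,n]∣m ρ q)
      y = ℕ.quotient (ℕ.gcd[m,n]∣n ρ q)
      ρ≡xg : ρ ≡ x ℕ.* g
      ρ≡xg = ℕ._∣_.equality (ℕ.gcd[m,n]∣m ρ q)
      q≡yg : q ≡ y ℕ.* g
      q≡yg = ℕ._∣_.equality (ℕ.gcd[m,n]∣n ρ q)
      ρ≡ : + ρ ≡ + x * + g
      ρ≡ = trans (cong +_ ρ≡xg) (pos-* x g)
      σq≡ : + σ * + q ≡ + (σ ℕ.* y) * + g
      σq≡ = trans (cong (λ z → + σ * z) (trans (cong +_ q≡yg) (pos-* y g)))
        (trans (sym (*-assoc (+ σ) (+ y) (+ g))) (cong (_* + g) (sym (pos-* σ y))))
      positive-factor : ∀ {m n o} → 1 ℕ.≤ m → m ≡ n ℕ.* o → 1 ℕ.≤ n × 1 ℕ.≤ o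
      positive-factor {n = suc n} {o = suc o} _ _ = s≤s z≤n , s≤s z≤n
      positive-factor {n = suc n} {o = zero} (s≤s _) eq = ⊥-elim (ℕ.1+n≢0 (trans eq (ℕ.*-zeroʳ n)))
      positive-factor {n = zero} (s≤s _) ()
      1≤x = positive-factor (drop‿+<+ 0<ρ) ρ≡xg
      1≤y = positive-factor (ℕ.>-nonZero⁻¹ q) q≡yg
      found = small-form⇒convergent (+≤+ z≤n) Q≤D a 1≤a alternating 0<D x (σ ℕ.* y)
        (proj₁ 1≤x) (ℕ.*-mono-≤ (drop‿+<+ 0<σ) (proj₁ 1≤y))
        (reduced-coprime ρ σ ∣n∣≡1 x y ρ≡xg q≡yg)
        (unit-small x (σ ℕ.* y) g ρ σ (proj₂ 1≤x) ∣n∣≡1 ρ≡ σq≡)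
    unit-convergent a 1≤a alternating 0<D Q≤D (+ _) -[1+ _ ] _ ()
    unit-convergent a 1≤a alternating 0<D Q≤D -[1+ _ ] _ ()

  -- Multiplication by the unit of a period.

  coprime-divisorℤ : ∀ {i j k} → Coprime ∣ i ∣ ∣ j ∣ → i ∣ j * k → i ∣ k
  coprime-divisorℤ {i} {j} {k} coprime i∣jk =
    ∣ᵤ⇒∣ (Coprimality.coprime-divisor coprime (subst (∣ i ∣ ℕ.∣_) (abs-* j k) (∣⇒∣ᵤ i∣jk)))

  -- Modulo `q`, the number `r′` is `r` times the invertible `A`.
  gcd-invariant : ∀ q {r r′} A z → Coprime ∣ A ∣ q → r′ ≡ r * A + z * + q → gcd r′ (+ q) ≡ gcd r (+ q)
  gcd-invariant q {r} {r′} A z A⊥q r′≡ = cong +_ (ℕ.∣-antisym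
    (ℕ.gcd-greatest g′∣r (ℕ.gcd[m,n]∣n ∣ r′ ∣ q))
    (ℕ.gcd-greatest g∣r′ (ℕ.gcd[m,n]∣n ∣ r ∣ q)))
    where
    g = ℕ.gcd ∣ r ∣ q
    g′ = ℕ.gcd ∣ r′ ∣ q
    g∣r′ : g ℕ.∣ ∣ r′ ∣
    g∣r′ = ∣⇒∣ᵤ {+ g} {r′} (subst (+ g ∣_) (sym r′≡)
      (∣m∣n⇒∣m+n (∣m⇒∣m*n A (∣ᵤ⇒∣ {+ g} {r} (ℕ.gcd[m,n]∣m ∣ r ∣ q))) (∣n⇒∣m*n z (∣ᵤ⇒∣ {+ g} {+ q} (ℕ.gcd[m,n]∣n ∣ r ∣ q)))))
    identity : ∀ A r z q → r * A + z * q - z * q ≡ A * r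
    identity = solve-∀
    g′∣r : g′ ℕ.∣ ∣ r ∣
    g′∣r = ∣⇒∣ᵤ {+ g′} {r} (coprime-divisorℤ {+ g′} {A} {r}
      (λ (c∣g′ , c∣A) → A⊥q (c∣A , ℕ.∣-trans c∣g′ (ℕ.gcd[m,n]∣n ∣ r′ ∣ q)))
      (subst (+ g′ ∣_) (trans (cong (_- z * + q) r′≡) (identity A r z (+ q)))
        (∣m∣n⇒∣m-n (∣ᵤ⇒∣ {+ g′} {r′} (ℕ.gcd[m,n]∣m ∣ r′ ∣ q)) (∣n⇒∣m*n z (∣ᵤ⇒∣ {+ g′} {+ q} (ℕ.gcd[m,n]∣n ∣ r′ ∣ q))))))

  -- The cofactors satisfy `Q = f² e`, `q = f e` and `d = D e`, so `√(D/Q) = √d / q`.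
  module _ (D Q q d e f : ℕ) .{{_ : ℕ.NonZero Q}} (D⊥Q : Coprime D Q)
    (Q≡fq : + Q ≡ + f * + q) (q≡fe : + q ≡ + f * + e) (d≡De : + d ≡ + D * + e)
    (A b c : ℤ) (1≤A : 1ℤ ≤ A) (1≤c : 1ℤ ≤ c) (∣A²-bc∣≡1 : ∣ A * A - b * c ∣ ≡ 1) (cD≡Qb : c * + D ≡ + Q * b) where

    private
      Q∣c : + Q ∣ c
      Q∣c = coprime-divisorℤ {+ Q} {+ D} {c} (Coprimality.sym D⊥Q)
        (subst (+ Q ∣_) (trans (sym cD≡Qb) (*-comm c (+ D))) (∣m⇒∣m*n b ∣-refl))

      j : ℤ
      j = _∣_.quotient Q∣c

      c≡jQ : c ≡ j * + Q
      c≡jQ = _∣_.equality Q∣c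

      b≡Dj : b ≡ + D * j
      b≡Dj = *-cancelˡ-≡ (+ Q) b (+ D * j)
        (trans (sym cD≡Qb) (trans (cong (_* + D) c≡jQ) (identity j (+ Q) (+ D))))
        where
        identity : ∀ j Q D → j * Q * D ≡ Q * (D * j)
        identity = solve-∀

      -- s₁ √d = c √(D/Q).
      s₁ : ℤ
      s₁ = + f * j

      0<j : 0ℤ < j
      0<j = pos-cancelʳ {j} {+ Q} (+≤+ z≤n) (subst (0ℤ <_) c≡jQ (<-≤-trans (+<+ (s≤s z≤n)) 1≤c))

      0<s₁ : 0ℤ < s₁
      0<s₁ = *-pos (pos-cancelʳ {+ f} {+ q} (+≤+ z≤n) (subst (0ℤ <_) Q≡fq (+<+ (ℕ.>-nonZero⁻¹ Q)))) 0<j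

      u₁ : ℤ[√ d ]
      u₁ = A +√ s₁

      ∣norm-u₁∣≡1 : ∣ norm u₁ ∣ ≡ 1
      ∣norm-u₁∣≡1 = trans (cong (λ z → ∣ A * A - z ∣) (sym bc≡ds₁²)) ∣A²-bc∣≡1
        where
        identity : ∀ D e f j → D * j * (j * (f * (f * e))) ≡ D * e * (f * j * (f * j))
        identity = solve-∀
        bc≡ds₁² : b * c ≡ + d * (s₁ * s₁)
        bc≡ds₁² = trans (cong₂ _*_ b≡Dj (trans c≡jQ (cong (j *_) (trans Q≡fq (cong (+ f *_) q≡fe)))))
          (trans (identity (+ D) (+ e) (+ f) j) (cong (_* (s₁ * s₁)) (sym d≡De)))

      -- This makes the rational part of `u · u₁` congruent to `r A` modulo `q`.
      ds₁≡Djq : + d * s₁ ≡ + D * j * + q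
      ds₁≡Djq = trans (cong (_* s₁) d≡De) (trans (identity (+ D) (+ e) (+ f) j) (cong (+ D * j *_) (sym q≡fe)))
        where
        identity : ∀ D e f j → D * e * (f * j) ≡ D * j * (f * e)
        identity = solve-∀

      s₁q≡c : s₁ * + q ≡ c
      s₁q≡c = trans (identity (+ f) j (+ q)) (trans (cong (j *_) (sym Q≡fq)) (sym c≡jQ))
        where
        identity : ∀ f j q → f * j * q ≡ j * (f * q)
        identity = solve-∀

      -- Since `s₁ q = c`, the determinant `A² - (b s₁) q` equals `A² - b c`, which is `1` or `-1`.
      A⊥q : Coprime ∣ A ∣ q
      A⊥q = ∣det∣≡1⇒coprime A (+ q) (b * s₁) A
        (trans (cong (λ z → ∣ A * A - z ∣) (trans (*-assoc b s₁ (+ q)) (cong (b *_) s₁q≡c))) ∣A²-bc∣≡1)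

    module _ (r s : ℤ) (0<r : 0ℤ < r) (0<s : 0ℤ < s) (∣n∣≡1 : ∣ norm {d} (r +√ s) ∣ ≡ 1) where

      private
        u : ℤ[√ d ]
        u = r +√ s

        open ℤ[√_] (u · u₁) renaming (re to r′; im to s′)

        r′≡ : r′ ≡ r * A + s * (+ D * j) * + q
        r′≡ = cong (λ z → r * A + z) (trans (identity₁ (+ d) s s₁) (trans (cong (s *_) ds₁≡Djq) (sym (*-assoc s (+ D * j) (+ q)))))
          where
          identity₁ : ∀ d s s₁ → d * (s * s₁) ≡ s * (d * s₁)
          identity₁ = solve-∀

        -- Distinguishes the new unit from `u`.
        s<s′ : s < s′
        s<s′ = 0<j-i⇒< (subst (0ℤ <_) (identity r s A s₁)
          (+-mono-<-≤ (*-pos 0<r 0<s₁) (*-nonNeg (<⇒≤ 0<s) (i≤j⇒0≤j-i 1≤A))))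
          where
          identity : ∀ r s A s₁ → r * s₁ + s * (A - 1ℤ) ≡ r * s₁ + s * A - s
          identity = solve-∀

        -- Multiplication by `u₁` acts on the pair `(r , s q)` as the matrix `(A , b ; c , A)` of a
        -- period, so the common factor `t` passes through; `im-pair` is the second coordinate.
        re-pair : ∀ t X Y → r ≡ t * X → s * + q ≡ t * Y → r′ ≡ t * (A * X + b * Y)
        re-pair t X Y r≡ sq≡ = trans r′≡ (trans (identity₁ r A s (+ D * j) (+ q))
          (trans (cong₂ (λ x y → A * x + + D * j * y) r≡ sq≡)
            (trans (identity₂ A (+ D * j) t X Y) (cong (λ z → t * (A * X + z * Y)) (sym b≡Dj)))))
          where
          identity₁ : ∀ r A s b q → r * A + s * b * q ≡ A * r + b * (s * q)
          identity₁ = solve-∀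
          identity₂ : ∀ A b t X Y → A * (t * X) + b * (t * Y) ≡ t * (A * X + b * Y)
          identity₂ = solve-∀

        im-pair : ∀ t X Y → r ≡ t * X → s * + q ≡ t * Y → s′ * + q ≡ t * (c * X + A * Y)
        im-pair t X Y r≡ sq≡ = trans (identity₁ r s A s₁ (+ q))
          (trans (cong (λ z → r * z + A * (s * + q)) s₁q≡c)
            (trans (cong₂ (λ x y → x * c + A * y) r≡ sq≡) (identity₂ A c t X Y)))
          where
          identity₁ : ∀ r s A s₁ q → (r * s₁ + s * A) * q ≡ r * (s₁ * q) + A * (s * q)
          identity₁ = solve-∀
          identity₂ : ∀ A c t X Y → t * X * c + A * (t * Y) ≡ t * (c * X + A * Y)
          identity₂ = solve-∀

      next-unit : ∀ t X Y → r ≡ t * X → s * + q ≡ t * Y →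
        ∃[ r″ ] ∃[ s″ ] IsUnit {d} (r″ +√ s″) × (_+√_ {d} r″ s″ ≢ u)
          × (r″ ≡ t * (A * X + b * Y) × s″ * + q ≡ t * (c * X + A * Y)) × gcd r″ (+ q) ≡ gcd r (+ q)
      next-unit t X Y r≡ sq≡ = r′ , s′ ,
        ∣norm∣≡1⇒unit (u · u₁) (trans (cong ∣_∣ (norm-· u u₁))
          (trans (abs-* (norm u) (norm u₁)) (cong₂ ℕ._*_ ∣n∣≡1 ∣norm-u₁∣≡1))) ,
        (λ eq → <-irrefl (sym (cong ℤ[√_].im eq)) s<s′) ,
        (re-pair t X Y r≡ sq≡ , im-pair t X Y r≡ sq≡) ,
        gcd-invariant q {r} {r′} A (s * (+ D * j)) A⊥q r′≡

-- Translation of the hypotheses and proof of the theorem.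

open PeriodicQuotients
open Units

open import Data.Integer as ℤ using (ℤ; +_)
open import Data.Integer.GCD using (gcd)
import Data.Integer.Properties as ℤ
open import Data.Nat as ℕ using (ℕ; suc; NonZero)
open import Data.Nat.Coprimality using (Coprime)
open import Data.Nat.Divisibility using (divides)
import Data.Nat.DivMod as ℕ
import Data.Nat.Properties as ℕ
open import Data.Product using (∃-syntax; _×_; _,_; proj₁; proj₂)
open import Data.Rational using (ℚ; 1ℚ; _/_; _<_; _*_; ↥_; ↧_)
import Data.Rational.Properties as ℚ
open import Data.Rational.Unnormalised using (mkℚᵘ)
import Data.Rational.Unnormalised.Properties as ℚᵘ
open import Data.Vec using (Vec)
open import Data.Vec.Relation.Unary.All using (All)
open import Function using (_∘_)
open import Relation.Binary.PropositionalEquality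

1</⇒< : ∀ D Q .{{_ : NonZero Q}} → 1ℚ < + D / Q → Q ℕ.< D
1</⇒< D (suc Q) 1<D/Q = ℤ.drop‿+<+ (subst₂ ℤ._<_ (ℤ.*-identityˡ (+ suc Q)) (ℤ.*-identityʳ (+ D))
  (ℚᵘ.drop-*<* (ℚᵘ.<-respʳ-≃ (ℚ.toℚᵘ-fromℚᵘ (mkℚᵘ (+ D) Q)) (ℚ.toℚᵘ-mono-< 1<D/Q))))

module Radicand (D Q q e f : ℕ) .{{_ : NonZero Q}} (Q≡fq : Q ≡ f ℕ.* q) (q²≡eQ : q ℕ.^ 2 ≡ e ℕ.* Q) where

  q-nonZero : NonZero q
  q-nonZero = ℕ.≢-nonZero λ q≡0 → ℕ.≢-nonZero⁻¹ Q (trans Q≡fq (trans (cong (f ℕ.*_) q≡0) (ℕ.*-zeroʳ f)))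

  q≡fe : q ≡ f ℕ.* e
  q≡fe = ℕ.*-cancelʳ-≡ q (f ℕ.* e) q {{q-nonZero}} (begin
    q ℕ.* q           ≡⟨ cong (q ℕ.*_) (ℕ.*-identityʳ q) ⟨
    q ℕ.^ 2           ≡⟨ q²≡eQ ⟩
    e ℕ.* Q           ≡⟨ cong (e ℕ.*_) Q≡fq ⟩
    e ℕ.* (f ℕ.* q)   ≡⟨ ℕ.*-assoc e f q ⟨
    e ℕ.* f ℕ.* q     ≡⟨ cong (ℕ._* q) (ℕ.*-comm e f) ⟩
    f ℕ.* e ℕ.* q     ∎)
    where open ≡-Reasoning

  -- The truncated division defining `D₁` is exact, because `Q` divides `q²`.
  Dq²/Q≡De : (D ℕ.* q ℕ.^ 2) ℕ./ Q ≡ D ℕ.* e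
  Dq²/Q≡De = trans (ℕ./-congˡ {o = Q} (trans (cong (D ℕ.*_) q²≡eQ) (sym (ℕ.*-assoc D e Q)))) (ℕ.m*n/n≡m (D ℕ.* e) Q)

  [Dq²/Q]Q≡Dq² : + ((D ℕ.* q ℕ.^ 2) ℕ./ Q) ℤ.* + Q ≡ + D ℤ.* (+ q ℤ.* + q)
  [Dq²/Q]Q≡Dq² = begin
    + ((D ℕ.* q ℕ.^ 2) ℕ./ Q) ℤ.* + Q  ≡⟨ cong (λ d → + d ℤ.* + Q) Dq²/Q≡De ⟩
    + (D ℕ.* e) ℤ.* + Q                ≡⟨ ℤ.pos-* (D ℕ.* e) Q ⟨
    + (D ℕ.* e ℕ.* Q)                  ≡⟨ cong +_ (trans (ℕ.*-assoc D e Q) (cong (D ℕ.*_) (sym q²≡eQ))) ⟩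
    + (D ℕ.* q ℕ.^ 2)                  ≡⟨ cong (λ n → + (D ℕ.* (q ℕ.* n))) (ℕ.*-identityʳ q) ⟩
    + (D ℕ.* (q ℕ.* q))                ≡⟨ trans (ℤ.pos-* D (q ℕ.* q)) (cong (+ D ℤ.*_) (ℤ.pos-* q q)) ⟩
    + D ℤ.* (+ q ℤ.* + q)              ∎
    where open ≡-Reasoning

theorem1 :
    (D Q : ℕ) .{{_ : NonZero D}} .{{_ : NonZero Q}} →
    Coprime D Q →
    1ℚ < + D / Q →
    (∀ (x : ℚ) → x * x ≢ + D / Q) →
    (q : ℕ) → LeastDivisorWithSquareMultipleOf Q q →
    (m b₀ : ℕ) (bs : Vec ℕ m) → 1 ℕ.≤ b₀ → All (1 ℕ.≤_) bs →
    sqrt (+ D / Q) HasExpansion periodic b₀ bs →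
    let D₁ = (D ℕ.* q ℕ.^ 2) ℕ./ Q
        c  = convergent (periodic b₀ bs)
    in
    (r s : ℤ) →
    let u = r +√ s
        t = gcd r (+ q)
    in
    IsUnit {D₁} u → lower (toReal {D₁} u) 1ℚ →
    (∃[ k ] r , s ℤ.* + q over t IsPairOf c k)
    ×
    (∀ k → r , s ℤ.* + q over t IsPairOf c k →
      ∃[ r′ ] ∃[ s′ ]
        IsUnit {D₁} (r′ +√ s′)
        × (_+√_ {D₁} r′ s′ ≢ u)
        × (r′ , s′ ℤ.* + q over t IsPairOf c (k ℕ.+ m ℕ.+ 1))
        × gcd r′ (+ q) ≡ t)
theorem1 D Q D⊥Q 1<D/Q _ q ((divides f Q≡fq , divides e q²≡eQ) , _) m b₀ bs 1≤b₀ 1≤bs expansion r s unit u>1 =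
  first , second
  where
  d = (D ℕ.* q ℕ.^ 2) ℕ./ Q
  a = periodic b₀ bs
  t = gcd r (+ q)
  u : ℤ[√ d ]
  u = r +√ s
  1≤a = periodic-positive b₀ bs 1≤b₀ 1≤bs
  alternating = expansion⇒alternating a 1≤a D Q expansion
  ∣n∣≡1 = unit⇒∣norm∣≡1 u unit
  0<r = unit>1⇒re>0 u ∣n∣≡1 u>1
  0<s = unit>1⇒im>0 u ∣n∣≡1 u>1
  Q<D = 1</⇒< D Q 1<D/Q
  open Radicand D Q q e f Q≡fq q²≡eQ
  ↥c = λ k → proj₁ (convergent-terms a 1≤a k)
  ↧c = λ k → proj₂ (convergent-terms a 1≤a k)

  first : ∃[ k ] r , s ℤ.* + q over t IsPairOf convergent a k
  first = in-lowest-terms (unit-convergent D Q q d [Dq²/Q]Q≡Dq² {{q-nonZero}} a 1≤a alternating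
    (ℤ.+<+ (ℕ.≤-<-trans ℕ.z≤n Q<D)) (ℤ.+≤+ (ℕ.<⇒≤ Q<D)) r s 0<r 0<s ∣n∣≡1)
    where
    in-lowest-terms : (∃[ k ] r ≡ t ℤ.* num a (suc k) × s ℤ.* + q ≡ t ℤ.* den a (suc k)) →
      ∃[ k ] r , s ℤ.* + q over t IsPairOf convergent a k
    in-lowest-terms (k , r≡ , sq≡) = k , trans r≡ (cong (t ℤ.*_) (sym (↥c k))) , trans sq≡ (cong (t ℤ.*_) (sym (↧c k)))

  a-end = periodic-end b₀ bs
  a-periodic = periodic-period b₀ bs
  open Period a m a-end a-periodic using (A; b; num-period; den-period; ∣Ad-bc∣≡1) renaming (c to γ; d to δ)
  δ≡A : δ ≡ A
  δ≡A = Period.d≡A a m a-end a-periodic 1≤a D Q alternating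

  -- The `k`-th convergent has index `suc k` in `num` and `den`, hence the two successors on the
  -- left.
  index : ∀ k → suc m ℕ.+ suc k ≡ suc (k ℕ.+ m ℕ.+ 1)
  index k = cong suc (trans (ℕ.+-comm m (suc k)) (ℕ.+-comm 1 (k ℕ.+ m)))

  second : ∀ k → r , s ℤ.* + q over t IsPairOf convergent a k →
      ∃[ r′ ] ∃[ s′ ] IsUnit {d} (r′ +√ s′) × (_+√_ {d} r′ s′ ≢ u)
        × (r′ , s′ ℤ.* + q over t IsPairOf convergent a (k ℕ.+ m ℕ.+ 1)) × gcd r′ (+ q) ≡ t
  second k (r≡ , sq≡) = one-period-later (next-unit D Q q d e f D⊥Q (trans (cong +_ Q≡fq) (ℤ.pos-* f q))
    (trans (cong +_ q≡fe) (ℤ.pos-* f e)) (trans (cong +_ Dq²/Q≡De) (ℤ.pos-* D e))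
    -- `γ` is a denominator, which unfolds to a numerator of the shifted sequence; this gives
    -- `1 ≤ γ`.
    A b γ (num≥1 a 1≤a (suc m)) (num≥1 (a ∘ suc) (1≤a ∘ suc) m)
    (trans (cong (λ z → ℤ.∣ A ℤ.* z ℤ.- b ℤ.* γ ∣) (sym δ≡A)) ∣Ad-bc∣≡1)
    (Period.Dc≡Qb a m a-end a-periodic 1≤a D Q alternating)
    r s 0<r 0<s ∣n∣≡1 t (num a (suc k)) (den a (suc k))
    (trans r≡ (cong (t ℤ.*_) (↥c k))) (trans sq≡ (cong (t ℤ.*_) (↧c k))))
    where
    K = k ℕ.+ m ℕ.+ 1
    num-later : A ℤ.* num a (suc k) ℤ.+ b ℤ.* den a (suc k) ≡ ↥ convergent a K
    num-later = trans (sym (num-period (suc k))) (trans (cong (num a) (index k)) (sym (↥c K)))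
    den-later : γ ℤ.* num a (suc k) ℤ.+ A ℤ.* den a (suc k) ≡ ↧ convergent a K
    den-later = trans (cong (λ z → γ ℤ.* num a (suc k) ℤ.+ z ℤ.* den a (suc k)) (sym δ≡A))
      (trans (sym (den-period (suc k))) (trans (cong (den a) (index k)) (sym (↧c K))))
    one-period-later :
      (∃[ r′ ] ∃[ s′ ] IsUnit {d} (r′ +√ s′) × (_+√_ {d} r′ s′ ≢ u)
        × (r′ ≡ t ℤ.* (A ℤ.* num a (suc k) ℤ.+ b ℤ.* den a (suc k)) ×
           s′ ℤ.* + q ≡ t ℤ.* (γ ℤ.* num a (suc k) ℤ.+ A ℤ.* den a (suc k)))
        × gcd r′ (+ q) ≡ t) →
      ∃[ r′ ] ∃[ s′ ] IsUnit {d} (r′ +√ s′) × (_+√_ {d} r′ s′ ≢ u)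
        × (r′ , s′ ℤ.* + q over t IsPairOf convergent a K) × gcd r′ (+ q) ≡ t
    one-period-later (r′ , s′ , unit′ , u′≢u , (r′≡ , s′q≡) , gcd≡) =
      r′ , s′ , unit′ , u′≢u ,
      (trans r′≡ (cong (t ℤ.*_) num-later) , trans s′q≡ (cong (t ℤ.*_) den-later)) , gcd≡
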